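{- Let $F$ be a sufficiently saturated model of a dimensional theory expanding the theory of fields, with dimension $\delta$. Let $A\subseteq F$ be a small set of parameters and let $X\subseteq F$ be a subset type-definable over $A$ satisfying \[0<\delta(X+X)=\delta(XX)=\delta(X)<\infty .\] Let $p$ be a generic type on $X$ over $A$. Then $\frac{p-p}{p-p}$ is a definable subfield of $F$, and $\delta\left(\frac{p-p}{p-p}\right)=\delta(X)$.
   Context: Dimension. Let $T$ be a complete first-order theory and $M\models T$. "Definable" means definable with parameters; $\operatorname{Def}(M)$ is the collection of sets definable in $M$ (subsets of finite Cartesian powers of $M$) with parameters from $M$. A (continuous, real-valued) dimension is a function $\delta:\operatorname{Def}(M)\to\mathbb{R}_{\ge 0}\cup\{+\infty\}$ such that for all definable $X,Y$: (1) $\delta(X\cup Y)=\max\{\delta(X),\delta(Y)\}$; (2) $\delta(X\times Y)=\delta(X)+\delta(Y)$ for $X,Y$ nonempty; (3) $\delta(X)=0$ if $X$ is finite; (4) $\delta(X\cap Y)\le\min\{\delta(X),\delta(Y)\}$; (5) for every definable surjection $f:X\to Y$ between nonempty sets, $\delta(Y)+\inf_{y\in Y}\delta(f^{ -1}(y))\le\delta(X)\le\delta(Y)+\sup_{y\in Y}\delta(f^{ -1}(y))$; and (continuity) for every formula $\phi(\bar x,\bar y)$ and reals $s<t$ there is a $\emptyset$-definable set $D$ with $\{a:\delta(\phi(\bar x,a))\le s\}\subseteq D\subseteq\{b:\delta(\phi(\bar x,b))<t\}$. $T$ is a dimensional theory if some model has such a $\delta$; by continuity $\delta(\phi(\bar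 x,a))$ depends only on $\operatorname{tp}(a/\emptyset)$, so $\delta$ transfers uniquely to all models of $T$ and is called the dimension of $T$. Partial types. A partial type is a consistent collection of formulas, possibly with parameters; a type-definable set over $A$ is the set of realizations of a partial type over $A$, and types are identified with their sets of realizations in the saturated model. For a partial type $\Gamma$, $\delta(\Gamma)=\inf\{\delta(\phi):\Gamma\models\phi\}$. A generic type on a set $X$ type-definable over $A$ (over $A$) is a complete type $p$ over $A$ extending the partial type defining $X$ with $\delta(p)=\delta(X)$. Set operations. For subsets $X,Y$ of a field, $X\pm Y=\{x\pm y\}$, $XY=\{xy\}$, with $x\in X,y\in Y$, and $\frac{X}{Y}=\{x/y:x\in X,\ y\in Y\setminus\{0\}\}$. -}

module Defs where

open import Algebra.Structures using (IsCommutativeRing)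
import Data.Empty.Polymorphic as Poly
open import Data.Fin using (Fin)
open import Data.List using (List)
open import Data.List.Membership.Propositional using () renaming (_∈_ to _∈ˡ_)
open import Data.List.Relation.Unary.All using (All)
open import Data.Nat using (ℕ; suc) renaming (_+_ to _+ℕ_)
open import Data.Product using (Σ; ∃; ∃₂; Σ-syntax; ∃-syntax; _×_; _,_; proj₁; proj₂)
open import Data.Rational using (ℚ; 0ℚ) renaming (_<_ to _<ℚ_; _-_ to _-ℚ_; -_ to -ℚ_; _+_ to _+ℚ_)
import Data.Rational.Properties as ℚ
open import Data.Sum using (_⊎_; inj₁; inj₂)
open import Data.Vec using (Vec; []; _∷_; _++_; lookup)
open import Data.Vec.Relation.Unary.All using () renaming (All to Allⱽ)
open import Function.Bundles using (_⇔_)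
open import Level using (Level; Lift; lift; _⊔_) renaming (suc to lsuc)
open import Relation.Binary.PropositionalEquality using (_≡_; _≢_; refl; cong; subst; module ≡-Reasoning)
open import Relation.Binary.Definitions using (tri<; tri≈; tri>)
open import Relation.Nullary using (¬_)
open import Relation.Unary using (Pred; _∈_; _∉_; _⊆_; _≐_; _∪_; _∩_; U; Satisfiable)

private variable
  ℓ a b c : Level
  n m k : ℕ

-- An element of [-∞ , +∞], given by the set {q ∈ ℚ : x < q}.  Under excluded
-- middle the open upper sets of ℚ are exactly the extended reals: the empty
-- set is +∞ and all of ℚ is -∞.

record ℝ̄ ℓ : Set (lsuc ℓ) where
  field
    Above  : Pred ℚ ℓ
    upward : ∀ {q r} → Above q → q <ℚ r → Above r
    open′  : ∀ {q} → Above q → ∃[ r ] r <ℚ q × Above r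

open ℝ̄ public

infix 4 _≤ᴿ_ _<ᴿ_ _≃ᴿ_
infixl 6 _+ᴿ_

_≤ᴿ_ _<ᴿ_ _≃ᴿ_ : ℝ̄ ℓ → ℝ̄ ℓ → Set ℓ
x ≤ᴿ y = Above y ⊆ Above x
x <ᴿ y = ∃[ q ] q ∈ Above x × q ∉ Above y
x ≃ᴿ y = x ≤ᴿ y × y ≤ᴿ x

0ᴿ : ℝ̄ ℓ
0ᴿ .Above q = Lift _ (0ℚ <ℚ q)
0ᴿ .upward (lift 0<q) q<r = lift (ℚ.<-trans 0<q q<r)
0ᴿ .open′ (lift 0<q) with ℚ.<-dense 0<q
... | r , 0<r , r<q = r , r<q , lift 0<r

∞ᴿ : ℝ̄ ℓ
∞ᴿ .Above _ = Poly.⊥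
∞ᴿ .upward ()
∞ᴿ .open′ ()

IsReal : ℝ̄ ℓ → Set ℓ
IsReal x = (∃[ q ] q ∈ Above x) × (∃[ q ] q ∉ Above x)

-- Only ever applied to values in [0 , +∞], so -∞ + ∞ does not arise.
_+ᴿ_ : ℝ̄ ℓ → ℝ̄ ℓ → ℝ̄ ℓ
(x +ᴿ y) .Above q = ∃₂ λ r s → Above x r × Above y s × r +ℚ s ≡ q
(x +ᴿ y) .upward {q} {t} (r , s , xr , ys , refl) q<t =
  r , s +ℚ (t -ℚ (r +ℚ s)) , xr , upward y ys s<s′ , r+s′≡t
  where
  open ≡-Reasoning
  d : ℚ
  d = t -ℚ (r +ℚ s)
  0<d : 0ℚ <ℚ d
  0<d = subst (_<ℚ d) (ℚ.+-inverseʳ (r +ℚ s)) (ℚ.+-monoˡ-< (-ℚ (r +ℚ s)) q<t)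
  s<s′ : s <ℚ s +ℚ d
  s<s′ = subst (_<ℚ s +ℚ d) (ℚ.+-identityʳ s) (ℚ.+-monoʳ-< s 0<d)
  r+s′≡t : r +ℚ (s +ℚ d) ≡ t
  r+s′≡t = begin
    r +ℚ (s +ℚ d)                       ≡⟨ ℚ.+-assoc r s d ⟨
    (r +ℚ s) +ℚ (t -ℚ (r +ℚ s))          ≡⟨ ℚ.+-comm (r +ℚ s) d ⟩
    (t +ℚ (-ℚ (r +ℚ s))) +ℚ (r +ℚ s)     ≡⟨ ℚ.+-assoc t (-ℚ (r +ℚ s)) (r +ℚ s) ⟩
    t +ℚ ((-ℚ (r +ℚ s)) +ℚ (r +ℚ s))     ≡⟨ cong (t +ℚ_) (ℚ.+-inverseˡ (r +ℚ s)) ⟩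
    t +ℚ 0ℚ                             ≡⟨ ℚ.+-identityʳ t ⟩
    t                                   ∎
(x +ᴿ y) .open′ (r , s , xr , ys , refl) with open′ x xr
... | r′ , r′<r , xr′ = r′ +ℚ s , ℚ.+-monoˡ-< s r′<r , r′ , s , xr′ , ys , refl

maxᴿ minᴿ : ℝ̄ ℓ → ℝ̄ ℓ → ℝ̄ ℓ
maxᴿ x y .Above = Above x ∩ Above y
maxᴿ x y .upward (xq , yq) q<r = upward x xq q<r , upward y yq q<r
maxᴿ x y .open′ {q} (xq , yq) with open′ x xq | open′ y yq
... | r , r<q , xr | s , s<q , ys with ℚ.<-cmp r s
...   | tri< r<s _ _ = s , s<q , upward x xr r<s , ys
...   | tri≈ _ refl _ = r , r<q , xr , ys
...   | tri> _ _ s<r = r , r<q , xr , upward y ys s<r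
minᴿ x y .Above = Above x ∪ Above y
minᴿ x y .upward (inj₁ xq) q<r = inj₁ (upward x xq q<r)
minᴿ x y .upward (inj₂ yq) q<r = inj₂ (upward y yq q<r)
minᴿ x y .open′ (inj₁ xq) with open′ x xq
... | r , r<q , xr = r , r<q , inj₁ xr
minᴿ x y .open′ (inj₂ yq) with open′ y yq
... | r , r<q , yr = r , r<q , inj₂ yr

infᴿ supᴿ : {I : Set ℓ} → (I → ℝ̄ ℓ) → ℝ̄ ℓ
infᴿ x .Above q = ∃[ i ] Above (x i) q
infᴿ x .upward (i , xq) q<r = i , upward (x i) xq q<r
infᴿ x .open′ (i , xq) with open′ (x i) xq
... | r , r<q , xr = r , r<q , i , xr
-- The intersection of the sets Above (x i) need not be open; this is its interior.
supᴿ x .Above q = ∃[ r ] r <ℚ q × (∀ i → Above (x i) r)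
supᴿ x .upward (s , s<q , xs) q<r = s , ℚ.<-trans s<q q<r , xs
supᴿ x .open′ (s , s<q , xs) with ℚ.<-dense s<q
... | r , s<r , r<q = r , r<q , s , s<r , xs

record Language ℓ : Set (lsuc ℓ) where
  field
    Fun : ℕ → Set ℓ
    Rel : ℕ → Set ℓ

  Symbol : Set ℓ
  Symbol = (∃ Fun) ⊎ (∃ Rel)

module _ (L : Language ℓ) where
  open Language L

  data Term (n : ℕ) : Set ℓ where
    var : Fin n → Term n
    fun : Fun k → Vec (Term n) k → Term n

  infixr 5 _⇒_
  data Formula (n : ℕ) : Set ℓ where
    _≈_         : Term n → Term n → Formula n
    rel         : Rel k → Vec (Term n) k → Formula n
    false       : Formula n
    _⇒_ _∧_ _∨_ : Formula n → Formula n → Formula n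
    all ex      : Formula (suc n) → Formula n

  Sentence : Set ℓ
  Sentence = Formula 0

  record Structure : Set (lsuc ℓ) where
    field
      Carrier : Set ℓ
      ⟦fun⟧   : ∀ {k} → Fun k → Vec Carrier k → Carrier
      ⟦rel⟧   : ∀ {k} → Rel k → Pred (Vec Carrier k) ℓ

module _ {L : Language ℓ} where

  module _ (M : Structure L) where
    open Structure M

    eval  : Vec Carrier n → Term L n → Carrier
    evals : Vec Carrier n → Vec (Term L n) k → Vec Carrier k
    eval v (var i)    = lookup v i
    eval v (fun f ts) = ⟦fun⟧ f (evals v ts)
    evals v []        = []
    evals v (t ∷ ts)  = eval v t ∷ evals v ts

    Sat : Formula L n → Pred (Vec Carrier n) ℓ
    Sat (s ≈ t)    v = eval v s ≡ eval v t
    Sat (rel R ts) v = ⟦rel⟧ R (evals v ts)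
    Sat false      v = Poly.⊥
    Sat (φ ⇒ ψ)    v = Sat φ v → Sat ψ v
    Sat (φ ∧ ψ)    v = Sat φ v × Sat ψ v
    Sat (φ ∨ ψ)    v = Sat φ v ⊎ Sat ψ v
    Sat (all φ)    v = ∀ x → Sat φ (x ∷ v)
    Sat (ex φ)     v = ∃[ x ] Sat φ (x ∷ v)

  Theory : Set (lsuc ℓ)
  Theory = Pred (Sentence L) ℓ

  infix 4 _⊨_ _⊢_
  _⊨_ : Structure L → Theory → Set ℓ
  M ⊨ T = ∀ σ → σ ∈ T → Sat M σ []

  -- Semantic consequence, not derivability.
  _⊢_ : Theory → Sentence L → Set (lsuc ℓ)
  T ⊢ σ = ∀ M → M ⊨ T → Sat M σ []

  Complete : Theory → Set (lsuc ℓ)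
  Complete T = (∃[ M ] M ⊨ T) × (∀ σ → T ⊢ σ ⊎ T ⊢ σ ⇒ false)

-- A formula φ(x̄ , ȳ) with parameters for ȳ; the first n variables are x̄.
record Def {L : Language ℓ} (M : Structure L) (n : ℕ) : Set ℓ where
  constructor _[_]
  field
    {arity} : ℕ
    formula : Formula L (n +ℕ arity)
    params  : Vec (Structure.Carrier M) arity

open Def public

-- |A| < |κ|, i.e. |A| ≤ |κ| and not |κ| ≤ |A|.
_≺_ : {X : Set a} → Pred X b → Set c → Set (a ⊔ b ⊔ c)
_≺_ {X = X} A κ =
  (Σ[ f ∈ (X → κ) ] (∀ {x y} → x ∈ A → y ∈ A → f x ≡ f y → x ≡ y)) ×
  ¬ (Σ[ g ∈ (κ → X) ] (∀ i → g i ∈ A) × (∀ {i j} → g i ≡ g j → i ≡ j))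

module _ {L : Language ℓ} (M : Structure L) where
  open Structure M

  ⟦_⟧ : Def M n → Pred (Vec Carrier n) ℓ
  ⟦ φ [ b ] ⟧ v = Sat M φ (v ++ b)

  negate : Def M n → Def M n
  negate (φ [ b ]) = (φ ⇒ false) [ b ]

  Over : Pred Carrier ℓ → Pred (Def M n) ℓ
  Over A D = Allⱽ A (params D)

  Finite : Pred (Vec Carrier n) ℓ → Set ℓ
  Finite X = ∃[ vs ] (∀ {v} → v ∈ X → v ∈ˡ vs)

  -- G is the graph of a surjection X → Y.
  record IsSurjection (X : Def M n) (Y : Def M k) (G : Def M (n +ℕ k)) : Set ℓ where
    field
      inside     : ∀ (x : Vec Carrier n) (y : Vec Carrier k) →
                   (x ++ y) ∈ ⟦ G ⟧ → x ∈ ⟦ X ⟧ × y ∈ ⟦ Y ⟧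
      total      : ∀ x → x ∈ ⟦ X ⟧ → Σ[ y ∈ Vec Carrier k ] (x ++ y) ∈ ⟦ G ⟧
      functional : ∀ (x : Vec Carrier n) (y y′ : Vec Carrier k) →
                   (x ++ y) ∈ ⟦ G ⟧ → (x ++ y′) ∈ ⟦ G ⟧ → y ≡ y′
      surjective : ∀ y → y ∈ ⟦ Y ⟧ → Σ[ x ∈ Vec Carrier n ] (x ++ y) ∈ ⟦ G ⟧

  -- The sets f⁻¹(y), y ∈ Y, each with all of its definitions.
  Fibre : Def M n → Def M k → Def M (n +ℕ k) → Set ℓ
  Fibre {n} X Y G =
    Σ[ Z ∈ Def M n ] ∃[ y ] y ∈ ⟦ Y ⟧ × ⟦ Z ⟧ ≐ (λ x → (x ++ y) ∈ ⟦ G ⟧)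

  -- Operations on definable sets are expressed by saying that Z defines the
  -- resulting set.  Together with `δ-cong` this makes δ a function of the set
  -- rather than of the formula chosen to define it.
  record Dimension : Set (lsuc ℓ) where
    field
      δ           : ∀ {n} → Def M n → ℝ̄ ℓ
      δ-cong      : ∀ {n} (X Y : Def M n) → ⟦ X ⟧ ≐ ⟦ Y ⟧ → δ X ≃ᴿ δ Y
      nonneg      : ∀ {n} (X : Def M n) → 0ᴿ ≤ᴿ δ X
      union       : ∀ {n} (X Y Z : Def M n) → ⟦ Z ⟧ ≐ ⟦ X ⟧ ∪ ⟦ Y ⟧ →
                    δ Z ≃ᴿ maxᴿ (δ X) (δ Y)
      product     : ∀ {n k} (X : Def M n) (Y : Def M k) (Z : Def M (n +ℕ k)) →
                    Satisfiable ⟦ X ⟧ → Satisfiable ⟦ Y ⟧ →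
                    (∀ x y → (x ++ y) ∈ ⟦ Z ⟧ ⇔ (x ∈ ⟦ X ⟧ × y ∈ ⟦ Y ⟧)) →
                    δ Z ≃ᴿ δ X +ᴿ δ Y
      finite      : ∀ {n} (X : Def M n) → Finite ⟦ X ⟧ → δ X ≃ᴿ 0ᴿ
      inter       : ∀ {n} (X Y Z : Def M n) → ⟦ Z ⟧ ≐ ⟦ X ⟧ ∩ ⟦ Y ⟧ →
                    δ Z ≤ᴿ minᴿ (δ X) (δ Y)
      fibre-lower : ∀ {n k} (X : Def M n) (Y : Def M k) (G : Def M (n +ℕ k)) →
                    Satisfiable ⟦ X ⟧ → Satisfiable ⟦ Y ⟧ → IsSurjection X Y G →
                    δ Y +ᴿ infᴿ {I = Fibre X Y G} (λ Z → δ (proj₁ Z)) ≤ᴿ δ X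
      fibre-upper : ∀ {n k} (X : Def M n) (Y : Def M k) (G : Def M (n +ℕ k)) →
                    Satisfiable ⟦ X ⟧ → Satisfiable ⟦ Y ⟧ → IsSurjection X Y G →
                    δ X ≤ᴿ δ Y +ᴿ supᴿ {I = Fibre X Y G} (λ Z → δ (proj₁ Z))
      continuity  : ∀ {n m} (φ : Formula L (n +ℕ m)) (s t : ℝ̄ ℓ) →
                    IsReal s → IsReal t → s <ᴿ t →
                    Σ[ D ∈ Formula L m ]
                      (∀ a → δ (_[_] {n = n} φ a) ≤ᴿ s → a ∈ Sat M D) ×
                      (∀ b → b ∈ Sat M D → δ (_[_] {n = n} φ b) <ᴿ t)

  FinitelySatisfiable : Pred (Def M n) ℓ → Set ℓ
  FinitelySatisfiable {n} Γ =
    (Ds : List (Def M n)) → All Γ Ds → ∃[ v ] All (λ D → v ∈ ⟦ D ⟧) Ds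

  PartialType : Pred Carrier ℓ → Pred (Def M n) ℓ → Set ℓ
  PartialType A Γ = Γ ⊆ Over A × FinitelySatisfiable Γ

  CompleteType : Pred Carrier ℓ → Pred (Def M n) ℓ → Set ℓ
  CompleteType A p = PartialType A p × (∀ D → D ∈ Over A → D ∈ p ⊎ negate D ∈ p)

  Realizations : Pred (Def M n) ℓ → Pred (Vec Carrier n) ℓ
  Realizations Γ v = ∀ D → D ∈ Γ → v ∈ ⟦ D ⟧

  Saturated : Set ℓ → Set (lsuc ℓ)
  Saturated κ = ∀ {n} (A : Pred Carrier ℓ) (Γ : Pred (Def M n) ℓ) →
    A ≺ κ → PartialType A Γ → Satisfiable (Realizations Γ)

  -- κ-saturated for an infinite κ > |L|; the small sets are then those of
  -- cardinality < κ.
  SufficientlySaturated : Set ℓ → Set (lsuc ℓ)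
  SufficientlySaturated κ =
    U {A = ℕ} ≺ κ × U {A = Language.Symbol L} ≺ κ × Saturated κ

  Subset : Set (lsuc ℓ)
  Subset = Pred Carrier ℓ

  ⟦_⟧₁ : Def M 1 → Subset
  ⟦ D ⟧₁ x = (x ∷ []) ∈ ⟦ D ⟧

  Realizations₁ : Pred (Def M 1) ℓ → Subset
  Realizations₁ Γ x = (x ∷ []) ∈ Realizations Γ

  module _ (dim : Dimension) where
    open Dimension dim

    -- δ(Γ) = inf {δ(φ) : Γ ⊨ φ} for a type Γ with set of realizations X.  In a
    -- saturated structure Γ ⊨ φ means that X is contained in φ(M).
    δ* : Subset → ℝ̄ ℓ
    δ* X = infᴿ {I = Σ[ D ∈ Def M 1 ] X ⊆ ⟦ D ⟧₁} (λ D → δ (proj₁ D))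

    -- Γ is the partial type over A defining the set on which p is generic.
    IsGeneric : Subset → (Γ p : Pred (Def M 1) ℓ) → Set ℓ
    IsGeneric A Γ p =
      CompleteType A p × Γ ⊆ p × δ* (Realizations₁ p) ≃ᴿ δ* (Realizations₁ Γ)

record RingSymbols (L : Language ℓ) : Set ℓ where
  open Language L
  field
    add mul : Fun 2
    neg     : Fun 1
    zero one : Fun 0

module FieldOps {L : Language ℓ} (R : RingSymbols L) (M : Structure L) where
  open RingSymbols R
  open Structure M

  infixl 6 _+_ _⊕_ _⊖_
  infixl 7 _*_ _⊗_ _⊘_

  _+_ _*_ : Carrier → Carrier → Carrier
  x + y = ⟦fun⟧ add (x ∷ y ∷ [])
  x * y = ⟦fun⟧ mul (x ∷ y ∷ [])

  -_ : Carrier → Carrier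
  - x = ⟦fun⟧ neg (x ∷ [])

  0# 1# : Carrier
  0# = ⟦fun⟧ zero []
  1# = ⟦fun⟧ one []

  record IsField : Set ℓ where
    field
      isCommutativeRing : IsCommutativeRing _≡_ _+_ _*_ -_ 0# 1#
      nontrivial        : 1# ≢ 0#
      inverse           : ∀ x → x ≢ 0# → ∃[ y ] x * y ≡ 1#

  _⊕_ _⊖_ _⊗_ _⊘_ : Subset M → Subset M → Subset M
  (X ⊕ Y) z = ∃₂ λ x y → x ∈ X × y ∈ Y × z ≡ x + y
  (X ⊖ Y) z = ∃₂ λ x y → x ∈ X × y ∈ Y × z ≡ x + (- y)
  (X ⊗ Y) z = ∃₂ λ x y → x ∈ X × y ∈ Y × z ≡ x * y
  -- z = x / y, written without a total inverse function.
  (X ⊘ Y) z = ∃₂ λ x y → x ∈ X × y ∈ Y × y ≢ 0# × z * y ≡ x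

  record IsSubfield (K : Subset M) : Set ℓ where
    field
      0∈    : 0# ∈ K
      1∈    : 1# ∈ K
      +-∈   : ∀ {x y} → x ∈ K → y ∈ K → x + y ∈ K
      neg-∈ : ∀ {x} → x ∈ K → - x ∈ K
      *-∈   : ∀ {x y} → x ∈ K → y ∈ K → x * y ∈ K
      inv-∈ : ∀ {x y} → x ∈ K → x ≢ 0# → x * y ≡ 1# → y ∈ K

-- The models of T are fields, in the language of rings inside L.
ExpandsFields : {L : Language ℓ} → RingSymbols L → Theory {L = L} → Set (lsuc ℓ)
ExpandsFields R T = ∀ M → M ⊨ T → FieldOps.IsField R M

{-# OPTIONS --safe #-}
-- Write e = δ(X).  If x is not in K = (p − p)/(p − p), then (a , b) ↦ a + xb is
-- injective on p × p, so p + xp has dimension 2e.  On the other hand the x for which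
-- p + xp has dimension e are closed under the field operations, by Ruzsa's triangle
-- inequality and submodularity for generic sums.  So K is a field once it is shown that
-- b/a is such an x for all realizations a, b of p.  As δ(XX) = e, every a ⊨ p has an
-- e-dimensional family of a′ ⊨ p for which ap ∩ a′p has dimension e, and then a′/a is
-- such an x.  As δ(X + X) = e, the sum of the families of a and b is not direct, which
-- makes b/a a quotient of such x.  The gap between e and 2e gives, by continuity, that K
-- is a union of sets definable over A, and by compactness finitely many of them suffice.
module Submission where

open import Defs
open import Algebra.Bundles using (CommutativeRing)
import Algebra.Properties.Ring as RingProperties
import Algebra.Solver.Ring.NaturalCoefficients.Default as SemiringSolver
open import Axiom.ExcludedMiddle using (ExcludedMiddle)
open import Data.Empty using (⊥; ⊥-elim)
import Data.Empty.Polymorphic as Poly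
open import Data.Fin using (Fin; zero; suc; _↑ˡ_; _↑ʳ_; splitAt; #_)
open import Data.Integer as ℤ using (-[1+_])
import Data.Integer.Properties as ℤ
open import Data.List using (List; []; _∷_) renaming (_++_ to _++ˡ_)
open import Data.List.Membership.Propositional using () renaming (_∈_ to _∈ˡ_)
import Data.List.Membership.Propositional.Properties as ∈ˡ
import Data.List.Properties as List
open import Data.List.Relation.Unary.All using (All; []; _∷_)
open import Data.List.Relation.Unary.Any using (here; there)
open import Data.Nat as ℕ using (ℕ; zero; suc) renaming (_+_ to _+ℕ_)
import Data.Nat.Properties as ℕ
open import Data.Product using (Σ-syntax; ∃-syntax; _×_; _,_; proj₁; proj₂; map₂)
open import Data.Rational as ℚ using (ℚ; 0ℚ; 1ℚ; mkℚ; toℚᵘ)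
import Data.Rational.Properties as ℚ
open import Data.Rational.Solver using (module +-*-Solver)
open import Data.Rational.Unnormalised as ℚᵘ using (mkℚᵘ; *≤*; *≡*)
import Data.Rational.Unnormalised.Properties as ℚᵘ
open import Data.Sum using (_⊎_; inj₁; inj₂; [_,_]′)
open import Data.Unit.Polymorphic using (⊤; tt)
open import Data.Vec using (Vec; []; _∷_; _++_; lookup; map; tabulate; toList; tail)
import Data.Vec.Membership.Propositional.Properties as ∈ⱽ
import Data.Vec.Properties as Vec
open import Data.Vec.Relation.Unary.All as Allⱽ using ([]; _∷_) renaming (All to Allⱽ)
import Data.Vec.Relation.Unary.All.Properties as Allⱽ
import Data.Vec.Relation.Unary.Any as Anyⱽ
import Data.Vec.Relation.Unary.Any.Properties as Anyⱽ
open import Function using (_∘_; id; mk⇔)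
open import Level using (Level; Lift; lift; lower)
open import Relation.Binary.Definitions using (tri<; tri≈; tri>)
open import Relation.Binary.PropositionalEquality hiding ([_]; J)
open import Relation.Nullary using (¬_; Dec; yes; no)
open import Relation.Nullary.Decidable using (decidable-stable)
open import Relation.Unary using (Pred; _∈_; _⊆_; _≐_; _∪_; _∩_; Satisfiable; U)

-- The hypotheses bound δ on X + X and XX through definable supersets, whereas the argument speaks
-- of independent realizations of p. The bridge is `d us cs`, the dimension of the type of `us` over
-- `A ∪ cs`. The fibre axioms alone give an infimum and a supremum over fibres; continuity turns
-- them into additivity of `d`. Every estimate is then a count in which a finite quantity is
-- cancelled from both sides. Algebra enters through `d-closure`: an element of dimension zero over
-- a tuple adds nothing to the tuple. Saturation supplies independent copies (`generic-copy`) and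
-- replaces automorphisms (`homogeneity`). One device recurs: if a pair has dimension 2e and some
-- value computed from it has dimension at most e < 2e, then a generic copy of the pair over that
-- value differs from it. Products yield linked elements this way, sums yield two decompositions of
-- a′ + b′, and a + xb yields a collision, which displays x as a quotient of differences.

private variable
  ℓ : Level
  n k n₁ n₂ : ℕ

-- The extended reals

private
  fromℕ : ℕ → ℚ
  fromℕ n = ℚ.fromℚᵘ (mkℚᵘ (ℤ.+ n) 0)

  fromℕ-suc : ∀ n → fromℕ (suc n) ≡ 1ℚ ℚ.+ fromℕ n
  fromℕ-suc n = ℚ.toℚᵘ-injective (ℚᵘ.≃-trans (ℚ.toℚᵘ-fromℚᵘ (mkℚᵘ (ℤ.+ suc n) 0))
    (ℚᵘ.≃-sym (ℚᵘ.≃-trans (ℚ.toℚᵘ-homo-+ 1ℚ (fromℕ n))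
      (ℚᵘ.≃-trans (ℚᵘ.+-congʳ (toℚᵘ 1ℚ) (ℚ.toℚᵘ-fromℚᵘ (mkℚᵘ (ℤ.+ n) 0)))
        (*≡* (cong (ℤ._* ℤ.+ 1) (cong (ℤ._+_ (ℤ.+ 1)) (ℤ.*-identityʳ (ℤ.+ n)))))))))

  ≤∣∣ : ∀ c → c ℤ.≤ ℤ.+ ℤ.∣ c ∣
  ≤∣∣ (ℤ.+ n)    = ℤ.≤-refl
  ≤∣∣ -[1+ n ] = ℤ.-≤+

  archimedean : ∀ q ε → 0ℚ ℚ.< ε → ∃[ n ] q ℚ.≤ fromℕ n ℚ.* ε
  archimedean (mkℚ c e _) (mkℚ (ℤ.+ zero) b _) (ℚ.*<* (ℤ.+<+ ()))
  archimedean (mkℚ c e _) (mkℚ -[1+ _ ] b _) (ℚ.*<* ())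
  archimedean q@(mkℚ c e _) ε@(mkℚ (ℤ.+ suc a) b _) _ = N , ℚ.toℚᵘ-cancel-≤
    (ℚᵘ.≤-respʳ-≃ (ℚᵘ.≃-sym (ℚᵘ.≃-trans (ℚ.toℚᵘ-homo-* (fromℕ N) ε)
      (ℚᵘ.*-congʳ {toℚᵘ ε} (ℚ.toℚᵘ-fromℚᵘ (mkℚᵘ (ℤ.+ N) 0))))) (*≤* bound))
    where
    -- With q = c/(e+1) and ε = (a+1)/(b+1), this gives Nε = |c|(a+1) ≥ |c| ≥ q.
    N = ℤ.∣ c ∣ ℕ.* suc b
    bound : c ℤ.* ℤ.+ (1 ℕ.* suc b) ℤ.≤ (ℤ.+ N ℤ.* ℤ.+ suc a) ℤ.* ℤ.+ suc e
    bound = begin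
      c ℤ.* ℤ.+ (1 ℕ.* suc b)              ≤⟨ ℤ.*-monoʳ-≤-nonNeg (ℤ.+ (1 ℕ.* suc b)) (≤∣∣ c) ⟩
      ℤ.+ ℤ.∣ c ∣ ℤ.* ℤ.+ (1 ℕ.* suc b)      ≡⟨ cong (λ z → ℤ.+ ℤ.∣ c ∣ ℤ.* ℤ.+ z) (ℕ.*-identityˡ (suc b)) ⟩
      ℤ.+ ℤ.∣ c ∣ ℤ.* ℤ.+ suc b              ≡⟨ ℤ.pos-* ℤ.∣ c ∣ (suc b) ⟨
      ℤ.+ N                                ≤⟨ ℤ.+≤+ (ℕ.≤-trans (ℕ.m≤m*n N (suc a)) (ℕ.m≤m*n (N ℕ.* suc a) (suc e))) ⟩
      ℤ.+ (N ℕ.* suc a ℕ.* suc e)          ≡⟨ ℤ.pos-* (N ℕ.* suc a) (suc e) ⟩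
      ℤ.+ (N ℕ.* suc a) ℤ.* ℤ.+ suc e        ≡⟨ cong (ℤ._* ℤ.+ suc e) (ℤ.pos-* N (suc a)) ⟩
      (ℤ.+ N ℤ.* ℤ.+ suc a) ℤ.* ℤ.+ suc e      ∎
      where open ℤ.≤-Reasoning

infix 4 _≼_

-- A record, so that x and y can be inferred.
record _≼_ (x y : ℝ̄ ℓ) : Set ℓ where
  constructor ⟨_⟩
  field ≼⇒≤ᴿ : x ≤ᴿ y

open _≼_ public

≼-refl : {x : ℝ̄ ℓ} → x ≼ x
≼-refl = ⟨ (λ z → z) ⟩

≼-trans : {x y z : ℝ̄ ℓ} → x ≼ y → y ≼ z → x ≼ z
≼-trans ⟨ x≤y ⟩ ⟨ y≤z ⟩ = ⟨ (λ zq → x≤y (y≤z zq)) ⟩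

infixr 9 _⟫_

_⟫_ : {x y z : ℝ̄ ℓ} → x ≼ y → y ≼ z → x ≼ z
_⟫_ = ≼-trans

≤-Above : (x : ℝ̄ ℓ) {q r : ℚ} → Above x q → q ℚ.≤ r → Above x r
≤-Above x {q} {r} xq q≤r with ℚ.<-cmp q r
... | tri< q<r _ _ = upward x xq q<r
... | tri≈ _ refl _ = xq
... | tri> _ _ r<q = ⊥-elim (ℚ.<-irrefl refl (ℚ.<-≤-trans r<q q≤r))

record Finite⁺ (x : ℝ̄ ℓ) : Set ℓ where
  constructor finite⁺
  field
    0≼     : 0ᴿ ≼ x
    bound  : ∃[ q ] Above x q

open Finite⁺ public

rational : ℚ → ℝ̄ ℓ
rational q .Above r = Lift _ (q ℚ.< r)
rational q .upward (lift q<r) r<s = lift (ℚ.<-trans q<r r<s)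
rational q .open′ (lift q<r) with ℚ.<-dense q<r
... | s , q<s , s<r = s , s<r , lift q<s

rational-isReal : ∀ q → IsReal {ℓ} (rational q)
rational-isReal q =
  (q ℚ.+ 1ℚ , lift (subst (ℚ._< q ℚ.+ 1ℚ) (ℚ.+-identityʳ q) (ℚ.+-monoʳ-< q (ℚ.*<* (ℤ.+<+ (ℕ.s≤s ℕ.z≤n)))))) ,
  (q , λ q<q → ℚ.<-irrefl refl (lower q<q))

module _ {x y : ℝ̄ ℓ} where
  open +-*-Solver

  +ᴿ-comm : x +ᴿ y ≼ y +ᴿ x
  +ᴿ-comm = ⟨ (λ { (r , s , yr , xs , refl) → s , r , xs , yr , ℚ.+-comm s r }) ⟩

  +ᴿ-mono : {x′ y′ : ℝ̄ ℓ} → x ≼ x′ → y ≼ y′ → x +ᴿ y ≼ x′ +ᴿ y′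
  +ᴿ-mono ⟨ f ⟩ ⟨ g ⟩ = ⟨ (λ { (r , s , xr , ys , eq) → r , s , f xr , g ys , eq }) ⟩

  x≼x+y : 0ᴿ ≼ y → x ≼ x +ᴿ y
  x≼x+y ⟨ 0≤y ⟩ = ⟨ (λ { (r , s , xr , ys , refl) → upward x xr
    (subst (ℚ._< r ℚ.+ s) (ℚ.+-identityʳ r) (ℚ.+-monoʳ-< r (lower (0≤y ys)))) }) ⟩

  x+y≼x : y ≼ 0ᴿ → x +ᴿ y ≼ x
  x+y≼x ⟨ y≤0 ⟩ = ⟨ (λ xq → below xq (open′ x xq)) ⟩
    where
    below : ∀ {q} → Above x q → (∃[ r ] r ℚ.< q × Above x r) → Above (x +ᴿ y) q
    below {q} xq (r , r<q , xr) =
      r , q ℚ.- r , xr , y≤0 (lift (subst (ℚ._< q ℚ.- r) (ℚ.+-inverseʳ r) (ℚ.+-monoˡ-< (ℚ.- r) r<q))) ,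
      solve 2 (λ r q → r :+ (q :- r) := q) refl r q

  finite-+ : Finite⁺ x → Finite⁺ y → Finite⁺ (x +ᴿ y)
  finite-+ (finite⁺ ⟨ 0≤x ⟩ (q , xq)) (finite⁺ ⟨ 0≤y ⟩ (r , yr)) = finite⁺ ⟨ (λ { (s , t , xs , yt , refl) →
    lift (subst (ℚ._< s ℚ.+ t) (ℚ.+-identityʳ 0ℚ) (ℚ.+-mono-< (lower (0≤x xs)) (lower (0≤y yt)))) }) ⟩
    (q ℚ.+ r , q , r , xq , yr , refl)

module _ {x y z : ℝ̄ ℓ} where

  +ᴿ-assocʳ : (x +ᴿ y) +ᴿ z ≼ x +ᴿ (y +ᴿ z)
  +ᴿ-assocʳ = ⟨ (λ { (r , _ , xr , (s , t , ys , zt , refl) , refl) →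
    r ℚ.+ s , t , (r , s , xr , ys , refl) , zt , ℚ.+-assoc r s t }) ⟩

  +ᴿ-assocˡ : x +ᴿ (y +ᴿ z) ≼ (x +ᴿ y) +ᴿ z
  +ᴿ-assocˡ = ⟨ (λ { (_ , t , (r , s , xr , ys , refl) , zt , refl) →
    r , s ℚ.+ t , xr , (s , t , ys , zt , refl) , sym (ℚ.+-assoc r s t) }) ⟩

infix 4 _≋_

_≋_ : ℝ̄ ℓ → ℝ̄ ℓ → Set ℓ
x ≋ y = x ≼ y × y ≼ x

≃⇒≋ : {x y : ℝ̄ ℓ} → x ≃ᴿ y → x ≋ y
≃⇒≋ (f , g) = ⟨ f ⟩ , ⟨ g ⟩

module Classical (em : ∀ {a} → ExcludedMiddle a) where

  by-contradiction : ∀ {a} {A : Set a} → ¬ ¬ A → A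
  by-contradiction = decidable-stable em

  module _ (x : ℝ̄ ℓ) where
    open +-*-Solver

    private
      descend : {l : ℚ} (ε : ℚ) → ¬ Above x l →
                ∀ n u → Above x u → u ℚ.≤ l ℚ.+ fromℕ n ℚ.* ε →
                ∃[ r ] Above x r × ¬ Above x (r ℚ.- ε)
      descend {l} ε ¬xl zero u xu u≤ = ⊥-elim (¬xl (≤-Above x xu
        (subst (u ℚ.≤_) (solve 2 (λ l ε → l :+ con 0ℚ :* ε := l) refl l ε) u≤)))
      descend {l} ε ¬xl (suc n) u xu u≤ with em {P = Above x (u ℚ.- ε)}
      ... | no ¬p = u , xu , ¬p
      ... | yes p = descend ε ¬xl n (u ℚ.- ε) p
        (subst (u ℚ.- ε ℚ.≤_) (trans (cong (λ z → l ℚ.+ z ℚ.* ε ℚ.- ε) (fromℕ-suc n))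
          (solve 3 (λ l ε n → l :+ (con 1ℚ :+ n) :* ε :- ε := l :+ n :* ε) refl l ε (fromℕ n)))
          (ℚ.+-monoˡ-≤ (ℚ.- ε) u≤))

    -- Walk down from an upper bound in steps of ε. The cut excludes 0, so by the archimedean
    -- property some step leaves it.
    cut-gap : Finite⁺ x → ∀ ε → 0ℚ ℚ.< ε → ∃[ r ] Above x r × ¬ Above x (r ℚ.- ε)
    cut-gap (finite⁺ ⟨ 0≤x ⟩ (u , xu)) ε 0<ε = from (archimedean u ε 0<ε)
      where
      from : ∃[ n ] u ℚ.≤ fromℕ n ℚ.* ε → ∃[ r ] Above x r × ¬ Above x (r ℚ.- ε)
      from (n , u≤nε) = descend {0ℚ} ε (λ x0 → ℚ.<-irrefl {0ℚ} refl (lower (0≤x x0))) n u xu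
        (subst (u ℚ.≤_) (sym (ℚ.+-identityˡ (fromℕ n ℚ.* ε))) u≤nε)

  module _ {x y z : ℝ̄ ℓ} where
    open +-*-Solver

    private
      overshoot : ∀ {s r q s′ t} → s′ ℚ.+ t ≡ s ℚ.+ r → q ℚ.≤ t → s′ ℚ.≤ s ℚ.- (q ℚ.- r)
      overshoot {s} {r} {q} {s′} {t} eq q≤t = subst₂ ℚ._≤_
        (solve 2 (λ s′ t → (s′ :+ t) :- t := s′) refl s′ t)
        (trans (cong (ℚ._- q) eq) (solve 3 (λ s r q → s :+ r :- q := s :- (q :- r)) refl s r q))
        (ℚ.+-monoʳ-≤ (s′ ℚ.+ t) (ℚ.neg-antimono-≤ q≤t))

    -- Cancellation fails at +∞. For finite `x`, take `s` above `x` with `s - (q - r)` not above it.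
    -- Splitting `s + r` as `s′ + t` over `x + y` forces `t < q`, for otherwise `s′` would lie at or
    -- below that excluded point.
    +ᴿ-cancelˡ : Finite⁺ x → x +ᴿ y ≼ x +ᴿ z → y ≼ z
    +ᴿ-cancelˡ fx ⟨ x+y≤x+z ⟩ = ⟨ (λ {q} zq → from q (open′ z zq)) ⟩
      where
      from : ∀ q → (∃[ r ] r ℚ.< q × Above z r) → Above y q
      from q (r , r<q , zr) =
        let 0<ε = subst (ℚ._< q ℚ.- r) (ℚ.+-inverseʳ r) (ℚ.+-monoˡ-< (ℚ.- r) r<q)
            s , xs , ¬xs-ε = cut-gap x fx (q ℚ.- r) 0<ε
            s′ , t , xs′ , yt , eq = x+y≤x+z (s , r , xs , zr , refl)
        in upward y yt (ℚ.≰⇒> λ q≤t → ¬xs-ε (≤-Above x xs′ (overshoot {s} {r} eq q≤t)))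

-- Renaming of variables

under : (Fin n → Fin n₁) → Fin (suc n) → Fin (suc n₁)
under σ zero    = zero
under σ (suc i) = suc (σ i)

copair : (Fin n → Fin n₂) → (Fin n₁ → Fin n₂) → Fin (n +ℕ n₁) → Fin n₂
copair {n} f g i = [ f , g ]′ (splitAt n i)

module _ {L : Language ℓ} where

  renᵗ  : (Fin n → Fin n₁) → Term L n → Term L n₁
  renᵗˢ : (Fin n → Fin n₁) → Vec (Term L n) k → Vec (Term L n₁) k
  renᵗ σ (var i)    = var (σ i)
  renᵗ σ (fun f ts) = fun f (renᵗˢ σ ts)
  renᵗˢ σ []        = []
  renᵗˢ σ (t ∷ ts)  = renᵗ σ t ∷ renᵗˢ σ ts

  ren : (Fin n → Fin n₁) → Formula L n → Formula L n₁
  ren σ (s ≈ t)    = renᵗ σ s ≈ renᵗ σ t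
  ren σ (rel R ts) = rel R (renᵗˢ σ ts)
  ren σ false      = false
  ren σ (φ ⇒ ψ)    = ren σ φ ⇒ ren σ ψ
  ren σ (φ ∧ ψ)    = ren σ φ ∧ ren σ ψ
  ren σ (φ ∨ ψ)    = ren σ φ ∨ ren σ ψ
  ren σ (all φ)    = all (ren (under σ) φ)
  ren σ (ex φ)     = ex (ren (under σ) φ)

-- A relation between assignments rather than an operation on them: the single lemma `Sat-ren` then
-- covers weakening, selection of variables and the exchange of variables with parameters.
record Agree {C : Set ℓ} (σ : Fin n → Fin n₁) (v : Vec C n) (w : Vec C n₁) : Set ℓ where
  constructor agree
  field at : ∀ i → lookup w (σ i) ≡ lookup v i

open Agree

module _ {C : Set ℓ} where

  agree-under : {σ : Fin n → Fin n₁} {v : Vec C n} {w : Vec C n₁} → Agree σ v w →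
                ∀ x → Agree (under σ) (x ∷ v) (x ∷ w)
  agree-under a x .at zero    = refl
  agree-under a x .at (suc i) = a .at i

  agree-copair : {f : Fin n → Fin n₂} {g : Fin n₁ → Fin n₂} {v : Vec C n} {b : Vec C n₁} {w : Vec C n₂} →
                 Agree f v w → Agree g b w → Agree (copair f g) (v ++ b) w
  agree-copair {n = n} {f = f} {g} {v} {b} {w} agreeˡ agreeʳ .at i =
    trans (split (splitAt n i)) (sym (Vec.lookup-splitAt n v b i))
    where
    split : ∀ s → lookup w ([ f , g ]′ s) ≡ [ lookup v , lookup b ]′ s
    split (inj₁ j) = agreeˡ .at j
    split (inj₂ j) = agreeʳ .at j

  agree-↑ˡ : {v : Vec C n} (b : Vec C n₁) → Agree (_↑ˡ n₁) v (v ++ b)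
  agree-↑ˡ {v = v} b = agree (Vec.lookup-++ˡ v b)

  agree-↑ʳ : (v : Vec C n) {b : Vec C n₁} → Agree (n ↑ʳ_) b (v ++ b)
  agree-↑ʳ v {b} = agree (Vec.lookup-++ʳ v b)

  agree-∘ : {f : Fin n → Fin n₁} {g : Fin n₁ → Fin n₂} {u : Vec C n} {v : Vec C n₁} {w : Vec C n₂} →
            Agree f u v → Agree g v w → Agree (λ i → g (f i)) u w
  agree-∘ {f = f} a b = agree λ i → trans (b .at (f i)) (a .at i)

  select : Vec C n → Vec (Fin n) k → Vec C k
  select v σ = map (lookup v) σ

  agree-select : {v : Vec C n} (σ : Vec (Fin n) k) → Agree (lookup σ) (select v σ) v
  agree-select {v = v} σ = agree λ i → sym (Vec.lookup-map i (lookup v) σ)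

  select-tabulate : {v : Vec C n} {f : Fin k → Fin n} {u : Vec C k} → Agree f u v → select v (tabulate f) ≡ u
  select-tabulate {v = v} {f} {u} a = trans (sym (Vec.tabulate-∘ (lookup v) f))
    (trans (Vec.tabulate-cong (a .at)) (Vec.tabulate∘lookup u))

-- Definable predicates and their closure properties

module Definability {L : Language ℓ} (F : Structure L) where
  open Structure F renaming (Carrier to C)

  eval-ren  : {σ : Fin n → Fin n₁} {v : Vec C n} {w : Vec C n₁} → Agree σ v w →
              ∀ t → eval F w (renᵗ σ t) ≡ eval F v t
  evals-ren : {σ : Fin n → Fin n₁} {v : Vec C n} {w : Vec C n₁} → Agree σ v w →
              (ts : Vec (Term L n) k) → evals F w (renᵗˢ σ ts) ≡ evals F v ts
  eval-ren a (var i)    = a .at i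
  eval-ren a (fun f ts) = cong (⟦fun⟧ f) (evals-ren a ts)
  evals-ren a []        = refl
  evals-ren a (t ∷ ts)  = cong₂ _∷_ (eval-ren a t) (evals-ren a ts)

  Sat-ren : {σ : Fin n → Fin n₁} {v : Vec C n} {w : Vec C n₁} → Agree σ v w →
            ∀ φ → (Sat F (ren σ φ) w → Sat F φ v) × (Sat F φ v → Sat F (ren σ φ) w)
  Sat-ren a (s ≈ t) =
    (λ e → trans (sym (eval-ren a s)) (trans e (eval-ren a t))) ,
    (λ e → trans (eval-ren a s) (trans e (sym (eval-ren a t))))
  Sat-ren a (rel R ts) = subst (⟦rel⟧ R) (evals-ren a ts) , subst (⟦rel⟧ R) (sym (evals-ren a ts))
  Sat-ren a false = id , id
  Sat-ren a (φ ⇒ ψ) =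
    (λ h x → proj₁ (Sat-ren a ψ) (h (proj₂ (Sat-ren a φ) x))) ,
    (λ h x → proj₂ (Sat-ren a ψ) (h (proj₁ (Sat-ren a φ) x)))
  Sat-ren a (φ ∧ ψ) =
    (λ (x , y) → proj₁ (Sat-ren a φ) x , proj₁ (Sat-ren a ψ) y) ,
    (λ (x , y) → proj₂ (Sat-ren a φ) x , proj₂ (Sat-ren a ψ) y)
  Sat-ren a (φ ∨ ψ) =
    [ inj₁ ∘ proj₁ (Sat-ren a φ) , inj₂ ∘ proj₁ (Sat-ren a ψ) ]′ ,
    [ inj₁ ∘ proj₂ (Sat-ren a φ) , inj₂ ∘ proj₂ (Sat-ren a ψ) ]′
  Sat-ren a (all φ) =
    (λ h x → proj₁ (Sat-ren (agree-under a x) φ) (h x)) ,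
    (λ h x → proj₂ (Sat-ren (agree-under a x) φ) (h x))
  Sat-ren a (ex φ) =
    (λ (x , h) → x , proj₁ (Sat-ren (agree-under a x) φ) h) ,
    (λ (x , h) → x , proj₂ (Sat-ren (agree-under a x) φ) h)

  -- Sets can be built and reasoned about as predicates, while the record tracks where the
  -- parameters of a defining formula lie.
  record Dfn (B : Subset F) {n} (S : Pred (Vec C n) ℓ) : Set ℓ where
    constructor dfn
    field
      def    : Def F n
      over   : Over F B def
      define : ⟦ F ⟧ def ≐ S

  open Dfn public

  module _ {B : Subset F} where

    dfn-Def : {D : Def F n} → Over F B D → Dfn B (⟦ F ⟧ D)
    dfn-Def {D = D} o = dfn D o (id , id)

    dfn-≐ : {S T : Pred (Vec C n) ℓ} → S ≐ T → Dfn B S → Dfn B T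
    dfn-≐ (f , g) (dfn D o (h , k)) = dfn D o ((λ x → f (h x)) , (λ x → k (g x)))

    dfn-⊆ : {B′ : Subset F} {S : Pred (Vec C n) ℓ} → B ⊆ B′ → Dfn B S → Dfn B′ S
    dfn-⊆ f (dfn D o e) = dfn D (Allⱽ.map f o) e

    private
      module Merge {n} {S T : Pred (Vec C n) ℓ} (X : Dfn B S) (Y : Dfn B T) where
        a b : ℕ
        a = arity (def X)
        b = arity (def Y)

        left right : Formula L (n +ℕ (a +ℕ b))
        left  = ren (copair (_↑ˡ _) (λ j → n ↑ʳ (j ↑ˡ b))) (formula (def X))
        right = ren (copair (_↑ˡ _) (λ j → n ↑ʳ (a ↑ʳ j))) (formula (def Y))

        ps : Vec C (a +ℕ b)
        ps = params (def X) ++ params (def Y)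

        all-ps : Allⱽ B ps
        all-ps = Allⱽ.++⁺ (over X) (over Y)

        left-iff : ∀ v → (Sat F left (v ++ ps) → S v) × (S v → Sat F left (v ++ ps))
        left-iff v =
          let f , g = Sat-ren (agree-copair (agree-↑ˡ {v = v} ps)
                        (agree-∘ {v = ps} (agree-↑ˡ (params (def Y))) (agree-↑ʳ v))) (formula (def X))
          in (λ x → proj₁ (define X) (f x)) , (λ x → g (proj₂ (define X) x))

        right-iff : ∀ v → (Sat F right (v ++ ps) → T v) × (T v → Sat F right (v ++ ps))
        right-iff v =
          let f , g = Sat-ren (agree-copair (agree-↑ˡ {v = v} ps)
                        (agree-∘ {v = ps} (agree-↑ʳ (params (def X))) (agree-↑ʳ v))) (formula (def Y))
          in (λ x → proj₁ (define Y) (f x)) , (λ x → g (proj₂ (define Y) x))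

    dfn-∩ : {S T : Pred (Vec C n) ℓ} → Dfn B S → Dfn B T → Dfn B (λ v → S v × T v)
    dfn-∩ X Y = dfn ((left ∧ right) [ ps ]) all-ps
      ((λ {v} (x , y) → proj₁ (left-iff v) x , proj₁ (right-iff v) y) ,
       (λ {v} (x , y) → proj₂ (left-iff v) x , proj₂ (right-iff v) y))
      where open Merge X Y

    dfn-∪ : {S T : Pred (Vec C n) ℓ} → Dfn B S → Dfn B T → Dfn B (λ v → S v ⊎ T v)
    dfn-∪ X Y = dfn ((left ∨ right) [ ps ]) all-ps
      ((λ {v} → [ inj₁ ∘ proj₁ (left-iff v) , inj₂ ∘ proj₁ (right-iff v) ]′) ,
       (λ {v} → [ inj₁ ∘ proj₂ (left-iff v) , inj₂ ∘ proj₂ (right-iff v) ]′))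
      where open Merge X Y

    dfn-¬ : {S : Pred (Vec C n) ℓ} → Dfn B S → Dfn B (λ v → ¬ S v)
    dfn-¬ (dfn D o (f , g)) = dfn (negate F D) o ((λ h x → Poly.⊥-elim (h (g x))) , (λ h x → ⊥-elim (h (f x))))

    dfn-∃ : {S : Pred (Vec C (suc n)) ℓ} → Dfn B S → Dfn B (λ v → ∃[ x ] S (x ∷ v))
    dfn-∃ (dfn (φ [ b ]) o (f , g)) = dfn (ex φ [ b ]) o ((λ (x , h) → x , f h) , (λ (x , h) → x , g h))

    dfn-select : {S : Pred (Vec C k) ℓ} (σ : Vec (Fin n) k) → Dfn B S → Dfn B (λ v → S (select v σ))
    dfn-select {n = n} σ (dfn (φ [ b ]) o (f , g)) =
      dfn (ren (copair (λ i → lookup σ i ↑ˡ _) (n ↑ʳ_)) φ [ b ]) o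
        ((λ {v} h → f (proj₁ (iff v) h)) , (λ {v} h → proj₂ (iff v) (g h)))
      where
      iff = λ v → Sat-ren (agree-copair {w = v ++ b} (agree-∘ {v = v} (agree-select σ) (agree-↑ˡ b)) (agree-↑ʳ v)) φ

    dfn-tail : {S : Pred (Vec C n) ℓ} → Dfn B S → Dfn B (λ v → S (tail v))
    dfn-tail (dfn (φ [ b ]) o (f , g)) = dfn (ren suc φ [ b ]) o
      ((λ { {_ ∷ v} h → f (proj₁ (Sat-ren (agree λ _ → refl) φ) h) }) ,
       (λ { {_ ∷ v} h → proj₂ (Sat-ren (agree λ _ → refl) φ) (g h) }))

    dfn-inst : {S : Pred (Vec C (suc n)) ℓ} {c : C} → c ∈ B → Dfn B S → Dfn B (λ v → S (c ∷ v))
    dfn-inst {n = n} {c = c} c∈B (dfn (_[_] {n₁} φ b) o (f , g)) = dfn (ren σ φ [ c ∷ b ]) (c∈B ∷ o)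
        ((λ {v} h → f (proj₁ (Sat-ren (σ-agree v) φ) h)) , (λ {v} h → proj₂ (Sat-ren (σ-agree v) φ) (g h)))
      where
      σ : Fin (suc n +ℕ n₁) → Fin (n +ℕ suc n₁)
      σ zero    = n ↑ʳ zero
      σ (suc i) = copair (_↑ˡ suc n₁) (λ j → n ↑ʳ suc j) i
      σ-agree : ∀ v → Agree σ ((c ∷ v) ++ b) (v ++ (c ∷ b))
      σ-agree v .at zero    = Vec.lookup-++ʳ v (c ∷ b) zero
      σ-agree v .at (suc i) =
        agree-copair {w = v ++ (c ∷ b)} (agree-↑ˡ (c ∷ b)) (agree λ j → Vec.lookup-++ʳ v (c ∷ b) (suc j)) .at i

    dfn-≈ : (s t : Term L n) → Dfn B (λ v → eval F v s ≡ eval F v t)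
    dfn-≈ s t = dfn (ren (_↑ˡ 0) (s ≈ t) [ [] ]) [] ((λ {v} → proj₁ (iff v)) , (λ {v} → proj₂ (iff v)))
      where
      iff = λ v → Sat-ren (agree-↑ˡ {v = v} []) (s ≈ t)

    dfn-false : Dfn B {n = n} (λ _ → Poly.⊥)
    dfn-false = dfn (false [ [] ]) [] (id , id)

    dfn-select≡ : (σ τ : Vec (Fin n) k) → Dfn B (λ v → select v σ ≡ select v τ)
    dfn-select≡ []      []      = dfn ((false ⇒ false) [ [] ]) [] ((λ _ → refl) , (λ _ ()))
    dfn-select≡ (i ∷ σ) (j ∷ τ) = dfn-≐ ((λ (e , f) → cong₂ _∷_ e f) , Vec.∷-injective)
      (dfn-∩ (dfn-≈ (var i) (var j)) (dfn-select≡ σ τ))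

    dfn-singleton : {y : Vec C n} → Allⱽ B y → Dfn B (_≡ y)
    dfn-singleton [] = dfn ((false ⇒ false) [ [] ]) [] ((λ { {[]} _ → refl }) , (λ _ ()))
    dfn-singleton (px ∷ pxs) = dfn-≐
      ((λ { {_ ∷ _} (refl , refl) → refl }) , (λ { refl → refl , refl }))
      (dfn-∩ (dfn-inst px (dfn-≈ (var (suc zero)) (var zero))) (dfn-tail (dfn-singleton pxs)))

    dfn-∃⁺ : {S : Pred (Vec C (n +ℕ k)) ℓ} → Dfn B S → Dfn B (λ y → Σ[ v ∈ Vec C n ] S (v ++ y))
    dfn-∃⁺ {n = zero}  X = dfn-≐ ((λ s → [] , s) , (λ { ([] , s) → s })) X
    dfn-∃⁺ {n = suc n} X = dfn-≐ ((λ (v , x , s) → x ∷ v , s) , (λ { (x ∷ v , s) → v , x , s })) (dfn-∃⁺ {n = n} (dfn-∃ X))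

-- Cardinality of small sets

module Small (em : ∀ {a} → ExcludedMiddle a) {ℓ : Level} {X κ : Set ℓ} where
  open Classical em

  ≺-⊆ : {B B′ : Pred X ℓ} → B ⊆ B′ → B′ ≺ κ → B ≺ κ
  ≺-⊆ sub ((f , f-inj) , no-inj) =
    (f , λ x∈ y∈ → f-inj (sub x∈) (sub y∈)) , λ (g , g∈ , g-inj) → no-inj (g , (λ i → sub (g∈ i)) , g-inj)

  private
    -- Hilbert's hotel.
    avoid : U {A = ℕ} ≺ κ → ∀ k₀ → Σ[ s ∈ (κ → κ) ] (∀ k → s k ≢ k₀) × (∀ {i j} → s i ≡ s j → i ≡ j)
    avoid ((h , h-inj) , _) k₀ = t , t-avoids , λ {i} {j} → t-inj i j (em {P = s i ≡ k₀}) (em {P = s j ≡ k₀})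
      where
      shift : ∀ k → Dec (∃[ n ] h n ≡ k) → κ
      shift k (yes (n , _)) = h (suc n)
      shift k (no _)        = k
      s : κ → κ
      s k = shift k em
      suc-inj : ∀ {n n₁} → suc n ≡ suc n₁ → n ≡ n₁
      suc-inj refl = refl
      shift-inj : ∀ i j (a : Dec (∃[ n ] h n ≡ i)) (b : Dec (∃[ n ] h n ≡ j)) → shift i a ≡ shift j b → i ≡ j
      shift-inj i j (yes (n , refl)) (yes (n₁ , refl)) e = cong h (suc-inj (h-inj _ _ e))
      shift-inj i j (yes (n , _)) (no ¬h) e = ⊥-elim (¬h (suc n , e))
      shift-inj i j (no ¬h) (yes (n₁ , _)) e = ⊥-elim (¬h (suc n₁ , sym e))
      shift-inj i j (no _) (no _) e = e
      shift-avoids : ∀ k a → shift k a ≢ h 0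
      shift-avoids k (yes (n , _)) e with h-inj _ _ e
      ... | ()
      shift-avoids k (no ¬h) e = ¬h (0 , sym e)
      -- `shift` omits `h 0`; sending the point with value `k₀` to `h 0` makes `k₀` the omitted
      -- value instead.
      swap : ∀ r → Dec (r ≡ k₀) → κ
      swap r (yes _) = h 0
      swap r (no _)  = r
      t : κ → κ
      t k = swap (s k) em
      t-avoids′ : ∀ k (a : Dec (s k ≡ k₀)) → swap (s k) a ≢ k₀
      t-avoids′ k (yes e) e′ = shift-avoids k em (trans e (sym e′))
      t-avoids′ k (no ne) e′ = ne e′
      t-avoids : ∀ k → t k ≢ k₀
      t-avoids k = t-avoids′ k em
      t-inj : ∀ i j (a : Dec (s i ≡ k₀)) (b : Dec (s j ≡ k₀)) → swap (s i) em ≡ swap (s j) em → i ≡ j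
      swap-inj : ∀ i j (a : Dec (s i ≡ k₀)) (b : Dec (s j ≡ k₀)) → swap (s i) a ≡ swap (s j) b → i ≡ j
      swap-inj i j (yes e) (yes e′) _ = shift-inj i j em em (trans e (sym e′))
      swap-inj i j (yes e) (no _) e″  = ⊥-elim (shift-avoids j em (sym e″))
      swap-inj i j (no _) (yes _) e″  = ⊥-elim (shift-avoids i em e″)
      swap-inj i j (no _) (no _) e    = shift-inj i j em em e
      t-inj i j _ _ = swap-inj i j em em

  -- An injection of `B` into κ misses a value, since otherwise κ would embed in `B`; that value is
  -- free for `c`. Conversely, if κ embedded in `B` together with `c`, a self-injection of κ
  -- avoiding the preimage of `c` would embed it in `B`.
  ≺-insert : U {A = ℕ} ≺ κ → {B : Pred X ℓ} → B ≺ κ → ∀ c → (λ x → B x ⊎ x ≡ c) ≺ κ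
  ≺-insert ℕ≺κ {B} B≺κ@((f , f-inj) , no-inj) c with em {P = B c}
  ... | yes c∈B = ≺-⊆ (λ { (inj₁ x∈B) → x∈B ; (inj₂ refl) → c∈B }) B≺κ
  ... | no c∉B = (f′ , λ {x} {y} → f′-inj x y em em) , no-inj′
    where
    fresh : Σ[ k ∈ κ ] (∀ x → B x → f x ≢ k)
    fresh = by-contradiction λ none →
      let preimage : ∀ k → Σ[ x ∈ X ] B x × f x ≡ k
          preimage k = by-contradiction λ ¬p → none (k , λ x x∈B e → ¬p (x , x∈B , e))
      in no-inj ((λ k → proj₁ (preimage k)) , (λ k → proj₁ (proj₂ (preimage k))) ,
        λ {i} {j} e → trans (sym (proj₂ (proj₂ (preimage i)))) (trans (cong f e) (proj₂ (proj₂ (preimage j)))))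
    extend : ∀ x → Dec (x ≡ c) → κ
    extend x (yes _) = proj₁ fresh
    extend x (no _)  = f x
    f′ : X → κ
    f′ x = extend x em
    in-B : ∀ {x} → B x ⊎ x ≡ c → x ≢ c → B x
    in-B (inj₁ x∈B) _ = x∈B
    in-B (inj₂ e) ne  = ⊥-elim (ne e)
    f′-inj : ∀ x y (a : Dec (x ≡ c)) (b : Dec (y ≡ c)) → B x ⊎ x ≡ c → B y ⊎ y ≡ c →
             extend x em ≡ extend y em → x ≡ y
    extend-inj : ∀ x y (a : Dec (x ≡ c)) (b : Dec (y ≡ c)) → B x ⊎ x ≡ c → B y ⊎ y ≡ c →
                 extend x a ≡ extend y b → x ≡ y
    extend-inj x y (yes e) (yes e′) _ _ _   = trans e (sym e′)
    extend-inj x y (yes _) (no ne) _ y∈ e   = ⊥-elim (proj₂ fresh y (in-B y∈ ne) (sym e))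
    extend-inj x y (no ne) (yes _) x∈ _ e   = ⊥-elim (proj₂ fresh x (in-B x∈ ne) e)
    extend-inj x y (no ne) (no ne′) x∈ y∈ e = f-inj (in-B x∈ ne) (in-B y∈ ne′) e
    f′-inj x y _ _ = extend-inj x y em em
    no-inj′ : ¬ (Σ[ g ∈ (κ → X) ] (∀ i → B (g i) ⊎ g i ≡ c) × (∀ {i j} → g i ≡ g j → i ≡ j))
    no-inj′ (g , g∈ , g-inj) with em {P = Σ[ k₀ ∈ κ ] g k₀ ≡ c}
    ... | no ¬k = no-inj (g , (λ i → in-B (g∈ i) (λ e → ¬k (i , e))) , g-inj)
    ... | yes (k₀ , e) = let s , s-avoids , s-inj = avoid ℕ≺κ k₀ in
      no-inj ((λ i → g (s i)) , (λ i → in-B (g∈ (s i)) λ e′ → s-avoids i (g-inj (trans e′ (sym e)))) , λ e → s-inj (g-inj e))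

-- The dimension of a tuple over a small set

module Calculus (em : ∀ {a} → ExcludedMiddle a) {ℓ : Level} {L : Language ℓ} (F : Structure L) (dim : Dimension F)
  (κ : Set ℓ) (ℕ≺κ : U {A = ℕ} ≺ κ) (saturated : Saturated F κ) (A : Subset F) (A≺κ : A ≺ κ) where

  open Classical em
  open Small em
  open Dimension dim
  open Definability F public
  open Structure F renaming (Carrier to C) using ()

  base : List C → Subset F
  base cs x = A x ⊎ x ∈ˡ cs

  base-small : ∀ cs → base cs ≺ κ
  base-small []       = ≺-⊆ (λ { (inj₁ x) → x }) A≺κ
  base-small (c ∷ cs) = ≺-⊆ (λ { (inj₁ x) → inj₁ (inj₁ x) ; (inj₂ (here e)) → inj₂ e ; (inj₂ (there x)) → inj₁ (inj₂ x) })
    (≺-insert ℕ≺κ (base-small cs) c)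

  -- Directedness reduces finite satisfiability to the satisfiability of a single member of the
  -- family; `i₀` answers the empty list of formulas.
  compactness : {B : Subset F} → B ≺ κ → {I : Set ℓ} (S : I → Pred (Vec C n) ℓ) → (∀ i → Dfn B (S i)) → I →
                (∀ i j → Σ[ k ∈ I ] S k ⊆ S i ∩ S j) → (∀ i → Satisfiable (S i)) → Satisfiable (λ v → ∀ i → S i v)
  compactness {n = n} {B = B} B≺κ {I} S S-dfn i₀ directed S-sat =
    map₂ (λ r i → proj₁ (define (S-dfn i)) (r (def (S-dfn i)) (over (S-dfn i) , i , proj₂ (define (S-dfn i)))))
      (saturated B Γ B≺κ (proj₁ , λ Ds Γs → let i , below = common Ds Γs in map₂ below (S-sat i)))
    where
    Γ : Pred (Def F n) ℓ
    Γ D = Over F B D × Σ[ i ∈ I ] S i ⊆ ⟦ F ⟧ D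
    common : ∀ Ds → All Γ Ds → Σ[ i ∈ I ] (∀ {v} → S i v → All (λ D → v ∈ ⟦ F ⟧ D) Ds)
    common [] [] = i₀ , λ _ → []
    common (D ∷ Ds) ((_ , i , Si⊆D) ∷ Γs) =
      let j , below = common Ds Γs
          k , Sk⊆ = directed i j
      in k , λ v∈ → Si⊆D (proj₁ (Sk⊆ v∈)) ∷ below (proj₂ (Sk⊆ v∈))

  δ-mono : {D E : Def F n} → ⟦ F ⟧ D ⊆ ⟦ F ⟧ E → δ D ≼ δ E
  δ-mono {D = D} {E} D⊆E = ⟨ (λ q → inter E D D ((λ x → D⊆E x , x) , proj₂) (inj₁ q)) ⟩

  δ-≐ : {D E : Def F n} → ⟦ F ⟧ D ≐ ⟦ F ⟧ E → δ D ≋ δ E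
  δ-≐ (f , g) = δ-mono f , δ-mono g

  δ-nonneg : {D : Def F n} → 0ᴿ ≼ δ D
  δ-nonneg {D = D} = ⟨ nonneg D ⟩

  -- The fibre axioms measure fibres inside the full power, where a fibre of a projection is a slice
  -- times a point. The product and finiteness axioms equate its dimension with that of the slice.
  δ-times-point : (X : Def F n) (y : Vec C k) (W : Def F (n +ℕ k)) → Satisfiable (⟦ F ⟧ X) →
                  (∀ x y′ → (⟦ F ⟧ W (x ++ y′) → ⟦ F ⟧ X x × y′ ≡ y) × (⟦ F ⟧ X x × y′ ≡ y → ⟦ F ⟧ W (x ++ y′))) →
                  δ W ≋ δ X
  δ-times-point X y W X-sat W-iff =
    ≼-trans (proj₁ prod) (x+y≼x (proj₁ fin)) , ≼-trans (x≼x+y (proj₂ fin)) (proj₂ prod)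
    where
    point : Dfn (λ _ → ⊤) (_≡ y)
    point = dfn-singleton (Allⱽ.universal (λ _ → tt) y)
    fin : δ (def point) ≋ 0ᴿ
    fin = ≃⇒≋ (finite (def point) (y ∷ [] , λ v∈ → here (proj₁ (define point) v∈)))
    prod : δ W ≋ δ X +ᴿ δ (def point)
    prod = ≃⇒≋ (product X (def point) W X-sat (y , proj₂ (define point) refl) λ x y′ →
      mk⇔ (λ w → map₂ (proj₂ (define point)) (proj₁ (W-iff x y′) w))
          (λ xy → proj₂ (W-iff x y′) (map₂ (proj₁ (define point)) xy)))

  -- The fibre axioms are applied to coordinate maps `v ↦ select v σ` and to no other maps. Sums and
  -- products are treated later as coordinates of dimension zero over the remaining ones.
  module Image {n k : ℕ} {B : Subset F} {S : Pred (Vec C n) ℓ} (Z : Dfn B S) (σ : Vec (Fin n) k) where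

    private
      l : Vec (Fin (n +ℕ k)) n
      l = tabulate (_↑ˡ k)
      r σ′ : Vec (Fin (n +ℕ k)) k
      r = tabulate (n ↑ʳ_)
      σ′ = map (_↑ˡ k) σ

      l-select : ∀ (v : Vec C n) (y : Vec C k) → select (v ++ y) l ≡ v
      l-select v y = select-tabulate (agree-↑ˡ {v = v} y)
      r-select : ∀ (v : Vec C n) (y : Vec C k) → select (v ++ y) r ≡ y
      r-select v y = select-tabulate (agree-↑ʳ v {y})
      σ′-select : ∀ (v : Vec C n) (y : Vec C k) → select (v ++ y) σ′ ≡ select v σ
      σ′-select v y = trans (sym (Vec.map-∘ (lookup (v ++ y)) (_↑ˡ k) σ)) (Vec.map-cong (Vec.lookup-++ˡ v y) σ)

      InGraph : Pred (Vec C (n +ℕ k)) ℓ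
      InGraph w = S (select w l) × select w σ′ ≡ select w r
      graph : Dfn B InGraph
      graph = dfn-∩ (dfn-select l Z) (dfn-select≡ σ′ r)

      from-graph : ∀ (v : Vec C n) (y : Vec C k) → InGraph (v ++ y) → S v × select v σ ≡ y
      from-graph v y (s , e) = subst S (l-select v y) s , trans (sym (σ′-select v y)) (trans e (r-select v y))
      to-graph : ∀ (v : Vec C n) (y : Vec C k) → S v → select v σ ≡ y → InGraph (v ++ y)
      to-graph v y s e = subst S (sym (l-select v y)) s , trans (σ′-select v y) (trans e (sym (r-select v y)))

      G : ∀ (v : Vec C n) (y : Vec C k) → ⟦ F ⟧ (def graph) (v ++ y) → S v × select v σ ≡ y
      G v y g = from-graph v y (proj₁ (define graph) {v ++ y} g)
      G⁺ : ∀ (v : Vec C n) (y : Vec C k) → InGraph (v ++ y) → ⟦ F ⟧ (def graph) (v ++ y)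
      G⁺ v y = proj₂ (define graph) {v ++ y}

    InImage : Pred (Vec C k) ℓ
    InImage y = Σ[ v ∈ Vec C n ] InGraph (v ++ y)

    image : Dfn B InImage
    image = dfn-∃⁺ graph

    image⁺ : {v : Vec C n} {y : Vec C k} → S v → select v σ ≡ y → InImage y
    image⁺ {v} {y} s e = v , to-graph v y s e

    image⁻ : ∀ {y} → InImage y → Σ[ v ∈ Vec C n ] S v × select v σ ≡ y
    image⁻ {y} (v , g) = v , from-graph v y g

    private
      surjection : IsSurjection F (def Z) (def image) (def graph)
      surjection = record
        { inside = λ v y g → let s , e = G v y g in proj₂ (define Z) s , proj₂ (define image) (image⁺ s e)
        ; total = λ v v∈ → select v σ , G⁺ v (select v σ) (to-graph v (select v σ) (proj₁ (define Z) v∈) refl)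
        ; functional = λ v y y′ g g′ → trans (sym (proj₂ (G v y g))) (proj₂ (G v y′ g′))
        ; surjective = λ y y∈ → map₂ (λ {v} → G⁺ v y) (proj₁ (define image) y∈)
        }

      fibre : (Z′ : Fibre F (def Z) (def image) (def graph)) →
              let W , y , _ = Z′ in InImage y × ⟦ F ⟧ W ≐ (λ v → S v × select v σ ≡ y)
      fibre (W , y , y∈ , f , g) = proj₁ (define image) y∈ , (λ {v} w → G v y (f w)) ,
        λ {v} (s , e) → g (G⁺ v y (to-graph v y s e))

    module _ (Z-sat : Satisfiable S) where

      private
        Z-sat′ : Satisfiable (⟦ F ⟧ (def Z))
        Z-sat′ = map₂ (proj₂ (define Z)) Z-sat
        image-sat : Satisfiable (⟦ F ⟧ (def image))
        image-sat = select (proj₁ Z-sat) σ , proj₂ (define image) (image⁺ (proj₂ Z-sat) refl)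

      image-lower : {ρ : ℝ̄ ℓ} →
        (∀ W y → InImage y → ⟦ F ⟧ W ≐ (λ v → S v × select v σ ≡ y) → ρ ≼ δ W) →
        δ (def image) +ᴿ ρ ≼ δ (def Z)
      image-lower {ρ} ρ≼ = ≼-trans (+ᴿ-mono {y′ = infᴿ {I = Fibre F (def Z) (def image) (def graph)} λ Z′ → δ (proj₁ Z′)} ≼-refl
          ⟨ (λ { (Z′ , q) → let y∈ , e = fibre Z′ in ≼⇒≤ᴿ (ρ≼ (proj₁ Z′) _ y∈ e) q }) ⟩)
        ⟨ fibre-lower (def Z) (def image) (def graph) Z-sat′ image-sat surjection ⟩

      -- `supᴿ` is the interior of an intersection, so a common bound `r` for the fibres bounds the
      -- supremum only at a rational strictly larger than `r`.
      image-upper : {r r′ : ℚ} → r ℚ.< r′ →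
        (∀ W y → InImage y → ⟦ F ⟧ W ≐ (λ v → S v × select v σ ≡ y) → Above (δ W) r) →
        ∀ {s} → Above (δ (def image)) s → Above (δ (def Z)) (s ℚ.+ r′)
      image-upper r<r′ δ<r {s} δ<s = fibre-upper (def Z) (def image) (def graph) Z-sat′ image-sat surjection
        (s , _ , δ<s , (_ , r<r′ , λ Z′ → let y∈ , e = fibre Z′ in δ<r (proj₁ Z′) _ y∈ e) , refl)

  -- d us cs is δ(tp(us / A ∪ cs)).
  abstract
    d : Vec C n → List C → ℝ̄ ℓ
    d {n} us cs = infᴿ {I = Σ[ D ∈ Def F n ] Over F (base cs) D × us ∈ ⟦ F ⟧ D} (λ D → δ (proj₁ D))

    d⁺ : {us : Vec C n} {cs : List C} {q : ℚ} (D : Def F n) → Over F (base cs) D → ⟦ F ⟧ D us →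
         Above (δ D) q → Above (d us cs) q
    d⁺ D o us∈ δ<q = (D , o , us∈) , δ<q

    d⁻ : {us : Vec C n} {cs : List C} {q : ℚ} → Above (d us cs) q →
         Σ[ D ∈ Def F n ] Over F (base cs) D × ⟦ F ⟧ D us × Above (δ D) q
    d⁻ ((D , o , us∈) , δ<q) = D , o , us∈ , δ<q

  private variable
    us vs : Vec C n
    cs cs′ : List C

  d≼δ : {S : Pred (Vec C n) ℓ} (X : Dfn (base cs) S) → S us → d us cs ≼ δ (def X)
  d≼δ X s = ⟨ d⁺ (def X) (over X) (proj₂ (define X) s) ⟩

  0≼d : 0ᴿ ≼ d us cs
  0≼d = ⟨ (λ d<q → let D , _ , _ , δ<q = d⁻ d<q in nonneg D δ<q) ⟩

  d-base : base cs ⊆ base cs′ → d us cs′ ≼ d us cs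
  d-base sub = ⟨ (λ d<q → let D , o , us∈ , δ<q = d⁻ d<q in d⁺ D (Allⱽ.map sub o) us∈ δ<q) ⟩

  d-select : (us : Vec C n) (σ : Vec (Fin n) k) → d (select us σ) cs ≼ d us cs
  d-select us σ = ⟨ (λ d<q →
    let D , o , us∈ , δ<q = d⁻ d<q
        open Image (dfn-Def {D = D} o) σ
    in ≼⇒≤ᴿ (≼-trans (d≼δ image (image⁺ us∈ refl))
               (≼-trans (x≼x+y ≼-refl) (image-lower (us , us∈) (λ W y _ _ → δ-nonneg {D = W})))) δ<q) ⟩

  at-params : Def F (suc k) → Vec C k → Def F 1
  at-params E y = formula E [ y ++ params E ]

  over-at : (E : Def F (suc k)) (y : Vec C k) → Over F (base cs) E → Over F (base (toList y ++ˡ cs)) (at-params E y)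
  over-at {cs = cs} E y o = Allⱽ.++⁺ {P = base (toList y ++ˡ cs)} (go y id)
    (Allⱽ.map (λ { (inj₁ a) → inj₁ a ; (inj₂ c) → inj₂ (∈ˡ.∈-++⁺ʳ (toList y) c) }) o)
    where
    go : ∀ {j} (z : Vec C j) → (∀ {x} → x ∈ˡ toList z → x ∈ˡ toList y) → Allⱽ (base (toList y ++ˡ cs)) z
    go [] sub       = []
    go (x ∷ z) sub  = inj₂ (∈ˡ.∈-++⁺ˡ (sub (here refl))) ∷ go z (λ x∈ → sub (there x∈))

  separate : (vs : Vec C k) (ps : Vec C n₁) → Allⱽ (base (toList vs ++ˡ cs)) ps →
             Σ[ j ∈ ℕ ] Σ[ qs ∈ Vec C j ] Allⱽ (base cs) qs × Σ[ ρ ∈ (Fin n₁ → Fin (k +ℕ j)) ] Agree ρ ps (vs ++ qs)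
  separate vs [] [] = 0 , [] , [] , (λ ()) , agree λ ()
  separate {k = k} {cs = cs} vs (b ∷ ps) (p∈ ∷ ps∈) with separate {cs = cs} vs ps ps∈
  ... | j , qs , qs∈ , ρ , a = cases p∈
    where
    Result = Σ[ j ∈ ℕ ] Σ[ qs ∈ Vec C j ] Allⱽ (base cs) qs × Σ[ ρ ∈ (Fin (suc _) → Fin (k +ℕ j)) ] Agree ρ (b ∷ ps) (vs ++ qs)
    new : base cs b → Result
    new p∈ = suc j , b ∷ qs , p∈ ∷ qs∈ , ρ′ , a′
      where
      shift : Fin (k +ℕ j) → Fin (k +ℕ suc j)
      shift = copair (_↑ˡ suc j) (λ i → k ↑ʳ suc i)
      ρ′ : Fin (suc _) → Fin (k +ℕ suc j)
      ρ′ zero    = k ↑ʳ zero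
      ρ′ (suc i) = shift (ρ i)
      shift-agree : Agree shift (vs ++ qs) (vs ++ (b ∷ qs))
      shift-agree = agree-copair (agree-↑ˡ (b ∷ qs)) (agree λ i → Vec.lookup-++ʳ vs (b ∷ qs) (suc i))
      a′ : Agree ρ′ (b ∷ ps) (vs ++ (b ∷ qs))
      a′ .at zero    = Vec.lookup-++ʳ vs (b ∷ qs) zero
      a′ .at (suc i) = trans (shift-agree .at (ρ i)) (a .at i)
    old : ∀ i → lookup vs i ≡ b → Result
    old i e = j , qs , qs∈ , ρ′ , a′
      where
      ρ′ : Fin (suc _) → Fin (k +ℕ j)
      ρ′ zero    = i ↑ˡ j
      ρ′ (suc i) = ρ i
      a′ : Agree ρ′ (b ∷ ps) (vs ++ qs)
      a′ .at zero    = trans (Vec.lookup-++ˡ vs qs i) e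
      a′ .at (suc i) = a .at i
    cases : base (toList vs ++ˡ cs) b → Result
    cases (inj₁ p∈A) = new (inj₁ p∈A)
    cases (inj₂ p∈) with ∈ˡ.∈-++⁻ (toList vs) p∈
    ... | inj₂ p∈cs = new (inj₂ p∈cs)
    ... | inj₁ p∈vs = let i∈ = ∈ⱽ.∈-toList⁻ p∈vs in old (Anyⱽ.index i∈) (sym (Anyⱽ.lookup-index i∈))

  -- Writes `D` as the slice at `vs` of a set whose parameters avoid being counted over `vs`;
  -- continuity compares the slices of one formula, so this form is required. `separate` turns the
  -- parameters found in `vs` into variables and keeps the others.
  abstract-params : (vs : Vec C k) (D : Def F 1) → Over F (base (toList vs ++ˡ cs)) D →
                    Σ[ E ∈ Def F (suc k) ] Over F (base cs) E × ⟦ F ⟧ (at-params E vs) ≐ ⟦ F ⟧ D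
  abstract-params {cs = cs} vs (φ [ ps ]) o =
    let j , qs , qs∈ , ρ , a = separate {cs = cs} vs ps o
    in (ren (under ρ) φ [ qs ]) , qs∈ ,
       (λ { {x ∷ []} s → proj₁ (Sat-ren (agree-under a x) φ) s }) ,
       (λ { {x ∷ []} s → proj₂ (Sat-ren (agree-under a x) φ) s })

  select-tail : (v : Vec C (suc k)) → select v (tabulate suc) ≡ tail v
  select-tail (x ∷ v) = select-tabulate {v = x ∷ v} (agree λ _ → refl)

  -- As `T` restricts only the tail, the surviving fibres of the projection are whole slices of `E`.
  -- Bounds on the slices over `T` are therefore bounds on the fibres.
  module TailImage {B : Subset F} (E : Def F (suc k)) (T : Pred (Vec C k) ℓ)
    (Z : Dfn B (λ v → ⟦ F ⟧ E v × T (tail v))) where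
    open Image Z (tabulate suc) public

    image-tail⁻ : ∀ {y} → InImage y → ∃[ x ] ⟦ F ⟧ E (x ∷ y) × T y
    image-tail⁻ y∈ with image⁻ y∈
    ... | x ∷ v , (e , t) , eq with trans (sym (select-tail (x ∷ v))) eq
    ... | refl = x , e , t

    fibre-δ : ∀ W y → InImage y →
              ⟦ F ⟧ W ≐ (λ v → (⟦ F ⟧ E v × T (tail v)) × select v (tabulate suc) ≡ y) →
              T y × δ W ≋ δ (at-params E y)
    fibre-δ W y y∈ (f , g) with image-tail⁻ y∈
    ... | x , e , t = t , δ-times-point (at-params E y) y W (x ∷ [] , e) λ
      { (x′ ∷ []) y′ →
        (λ w → let (e′ , _) , eq = f w ; eq′ = trans (sym (select-tail (x′ ∷ y′))) eq
               in subst (λ z → ⟦ F ⟧ E (x′ ∷ z)) eq′ e′ , eq′) ,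
        (λ { (e′ , refl) → g ((e′ , t) , select-tail (x′ ∷ y′)) }) }

  <rational⇒Above : {x : ℝ̄ ℓ} {r : ℚ} → x <ᴿ rational r → Above x r
  <rational⇒Above {x} {r} (q , xq , q≯r) = ≤-Above x xq (ℚ.≮⇒≥ λ r<q → q≯r (lift r<q))

  -- Continuity at rational thresholds. Because θ contains every parameter with dimension at most
  -- `r`, its complement comes with the lower bound `r`, which is what `d-∷-≥` uses.
  θ-exists : ∀ {j} (φ : Formula L (1 +ℕ j)) {r s : ℚ} → r ℚ.< s →
    Σ[ θ ∈ Formula L j ] (∀ a → Above (δ (φ [ a ])) r → Sat F θ a) ×
                         (∀ b → Sat F θ b → Above (δ (φ [ b ])) s) ×
                         (∀ b → ¬ Sat F θ b → rational r ≼ δ (φ [ b ]))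
  θ-exists φ {r} {s} r<s =
    let θ , below , above = continuity {n = 1} φ (rational r) (rational s)
                              (rational-isReal r) (rational-isReal s) (s , lift r<s , λ s<s → ℚ.<-irrefl refl (lower s<s))
        below′ : ∀ a {t} → t ℚ.≤ r → Above (δ (φ [ a ])) t → Sat F θ a
        below′ a t≤r δ<t = below a λ r<q → upward (δ (φ [ a ])) δ<t (ℚ.≤-<-trans t≤r (lower r<q))
    in θ , (λ a → below′ a ℚ.≤-refl) , (λ b b∈ → <rational⇒Above {δ (φ [ b ])} (above b b∈)) ,
       λ b ¬θ → ⟨ (λ {t} δ<t → lift (ℚ.≰⇒> λ t≤r → ¬θ (below′ b t≤r δ<t))) ⟩

  -- d is additive: by continuity, a definable set containing (u , us) can be shrunk so that all
  -- of its fibres have dimension close to that of the fibre over us.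
  d-∷-≤ : (u : C) (us : Vec C n) → d (u ∷ us) cs ≼ d (u ∷ []) (toList us ++ˡ cs) +ᴿ d us cs
  d-∷-≤ {n} {cs = cs} u us = ⟨ (λ { (r , s , d<r , d<s , refl) →
      let D , o , u∈ , δ<r = d⁻ d<r ; Ψ , oΨ , us∈ , δ<s = d⁻ d<s in core D o u∈ δ<r Ψ oΨ us∈ δ<s }) ⟩
    where
    core : ∀ {r s} (D : Def F 1) → Over F (base (toList us ++ˡ cs)) D → ⟦ F ⟧ D (u ∷ []) → Above (δ D) r →
           (Ψ : Def F n) → Over F (base cs) Ψ → ⟦ F ⟧ Ψ us → Above (δ Ψ) s → Above (d (u ∷ us) cs) (r ℚ.+ s)
    core {r} {s} D o u∈ δ<r Ψ oΨ us∈ δ<s =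
      let E , oE , E≐D = abstract-params {cs = cs} us D o
          -- Two strict steps below `r`: `r₀ < r₁` is the gap demanded by continuity, `r₁ < r` the
          -- gap demanded by the supremum in `image-upper`.
          r₁ , r₁<r , δ<r₁ = open′ (δ D) δ<r
          r₀ , r₀<r₁ , δ<r₀ = open′ (δ D) δ<r₁
          θ , below , above , _ = θ-exists (formula E) r₀<r₁
          u∈E = proj₂ E≐D u∈
          us∈θ = below (us ++ params E) (≼⇒≤ᴿ (proj₁ (δ-≐ E≐D)) δ<r₀)
          θΨ = dfn-∩ (dfn-Def {D = θ [ params E ]} oE) (dfn-Def {D = Ψ} oΨ)
          Z = dfn-∩ (dfn-Def {D = E} oE) (dfn-tail θΨ)
          open TailImage E (λ y → ⟦ F ⟧ (θ [ params E ]) y × ⟦ F ⟧ Ψ y) Z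
          image⊆Ψ : ⟦ F ⟧ (def image) ⊆ ⟦ F ⟧ Ψ
          image⊆Ψ = λ y∈ → let _ , _ , _ , ψ = image-tail⁻ (proj₁ (define image) y∈) in ψ
          fibre< = λ W y y∈ W≐ → let (y∈θ , _) , W≋ = fibre-δ W y y∈ W≐
                                 in ≼⇒≤ᴿ (proj₁ W≋) (above (y ++ params E) y∈θ)
      in subst (Above (d (u ∷ us) cs)) (ℚ.+-comm s r)
           (≼⇒≤ᴿ (d≼δ Z (u∈E , us∈θ , us∈))
             (image-upper (u ∷ us , u∈E , us∈θ , us∈) r₁<r fibre< (≼⇒≤ᴿ (δ-mono {E = Ψ} image⊆Ψ) δ<s)))

  -- `drop` discards the base points in θ, whose slices may be small. The point `us` survives, as
  -- otherwise its slice of `D` would witness `Above d₁ r`. The remaining slices have dimension at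
  -- least `r - ε`, so the lower fibre inequality bounds the image, which contains `us`.
  d-∷-≥ : {cs : List C} (u : C) (us : Vec C n) → d (u ∷ []) (toList us ++ˡ cs) +ᴿ d us cs ≼ d (u ∷ us) cs
  d-∷-≥ {n} {cs} u us = ⟨ (λ d<q → let D , o , ∈D , δ<q = d⁻ d<q in split D o ∈D δ<q (open′ (δ D) δ<q)) ⟩
    where
    d₁ d₂ : ℝ̄ ℓ
    d₁ = d (u ∷ []) (toList us ++ˡ cs)
    d₂ = d us cs
    drop : ∀ {q₁ q r} (D : Def F (suc n)) → Over F (base cs) D → ⟦ F ⟧ D (u ∷ us) →
           Above (δ D) q₁ → q₁ ℚ.< q → ¬ Above d₁ r → Above d₂ (q ℚ.- r)
    drop {q₁} {q} {r} D o ∈D δ<q₁ q₁<q ¬d₁<r =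
      let ε = q ℚ.- q₁
          0<ε = subst (ℚ._< ε) (ℚ.+-inverseʳ q₁) (ℚ.+-monoˡ-< (ℚ.- q₁) q₁<q)
          r′ = r ℚ.- ε
          r′<r = subst (r′ ℚ.<_) (ℚ.+-identityʳ r) (ℚ.+-monoʳ-< r (ℚ.neg-antimono-< 0<ε))
          θ , _ , above , ¬θ⇒ = θ-exists (formula D) r′<r
          us∉θ : ¬ Sat F θ (us ++ params D)
          us∉θ = λ us∈θ → ¬d₁<r (d⁺ (at-params D us) (over-at {cs = cs} D us o) ∈D (above (us ++ params D) us∈θ))
          Z = dfn-∩ (dfn-Def {D = D} o) (dfn-tail (dfn-¬ (dfn-Def {D = θ [ params D ]} o)))
          open TailImage D (λ y → ¬ ⟦ F ⟧ (θ [ params D ]) y) Z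
          fibre≥ = λ W y y∈ W≐ → let y∉θ , W≋ = fibre-δ W y y∈ W≐
                                 in ≼-trans (¬θ⇒ (y ++ params D) y∉θ) (proj₂ W≋)
          s , t , δ<s , r′<t , s+t≡q₁ = ≼⇒≤ᴿ (≼-trans (image-lower (u ∷ us , ∈D , us∉θ) fibre≥)
                                                (δ-mono {E = D} (λ z → proj₁ (proj₁ (define Z) z)))) δ<q₁
      in ≤-Above d₂ (≼⇒≤ᴿ (d≼δ image (image⁺ (∈D , us∉θ) (select-tail (u ∷ us)))) δ<s)
           (s≤q-r s+t≡q₁ (lower r′<t))
      where
      open +-*-Solver using (solve; _:+_; _:-_; _:=_; con)
      s≤q-r : ∀ {s t} → s ℚ.+ t ≡ q₁ → r ℚ.- (q ℚ.- q₁) ℚ.< t → s ℚ.≤ q ℚ.- r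
      s≤q-r {s} {t} refl r′<t = ℚ.<⇒≤ (subst₂ ℚ._<_
        (solve 4 (λ q r s t → (r :- (q :- (s :+ t))) :+ (q :- r :- t) := s) refl q r s t)
        (solve 3 (λ q r t → t :+ (q :- r :- t) := q :- r) refl q r t)
        (ℚ.+-monoˡ-< (q ℚ.- r ℚ.- t) r′<t))
    split : ∀ {q} (D : Def F (suc n)) → Over F (base cs) D → ⟦ F ⟧ D (u ∷ us) →
            Above (δ D) q → ∃[ q₁ ] q₁ ℚ.< q × Above (δ D) q₁ → Above (d₁ +ᴿ d₂) q
    split {q} D o ∈D δ<q (q₁ , q₁<q , δ<q₁) =
      let ε = q ℚ.- q₁
          0<ε = subst (ℚ._< ε) (ℚ.+-inverseʳ q₁) (ℚ.+-monoˡ-< (ℚ.- q₁) q₁<q)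
          q₂ , q₂<q₁ , δ<q₂ = open′ (δ D) δ<q₁
          r , d₁<r , ¬d₁<r-ε = cut-gap d₁ (finite⁺ 0≼d inhabited) ε 0<ε
      in r , q ℚ.- r , d₁<r ,
         subst (Above d₂) (solve 3 (λ q q₁ r → q₁ :- (r :- (q :- q₁)) := q :- r) refl q q₁ r)
           (drop D o ∈D δ<q₂ q₂<q₁ ¬d₁<r-ε) ,
         solve 2 (λ q r → r :+ (q :- r) := q) refl q r
      where
      open +-*-Solver using (solve; _:+_; _:-_; _:=_; con)
      -- If `d₁` were infinite, `drop` with `r = q` would put 0 above `d₂`, which is nonnegative.
      inhabited : ∃[ r ] Above d₁ r
      inhabited = by-contradiction λ none →
        ℚ.<-irrefl refl (lower (≼⇒≤ᴿ 0≼d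
          (subst (Above d₂) (solve 1 (λ q → q :- q := con 0ℚ) refl q) (drop D o ∈D δ<q₁ q₁<q (λ x → none (q , x))))))

  d-point : {us : Vec C n} {cs : List C} → Dfn (base cs) (_≡ us) → d us cs ≼ 0ᴿ
  d-point {us = us} X = ≼-trans (d≼δ X refl) (proj₁ (≃⇒≋ (finite (def X) (us ∷ [] , λ v∈ → here (proj₁ (define X) v∈)))))

  d-base-point : {c : C} {cs : List C} → base cs c → d (c ∷ []) cs ≼ 0ᴿ
  d-base-point c∈ = d-point (dfn-singleton (c∈ ∷ []))

  d-drop : {us : Vec C n} {c : C} {cs : List C} → d us (c ∷ cs) ≼ d us cs
  d-drop = d-base λ { (inj₁ x) → inj₁ x ; (inj₂ x) → inj₂ (there x) }

  d-prefix : {us : Vec C n} (vs : Vec C k) {cs : List C} → d us (toList vs ++ˡ cs) ≼ d us cs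
  d-prefix vs = d-base λ { (inj₁ x) → inj₁ x ; (inj₂ x) → inj₂ (∈ˡ.∈-++⁺ʳ (toList vs) x) }

  d-⊆ : {us : Vec C n} {cs cs′ : List C} → (∀ {x} → x ∈ˡ cs → x ∈ˡ cs′) → d us cs′ ≼ d us cs
  d-⊆ sub = d-base λ { (inj₁ x) → inj₁ x ; (inj₂ x) → inj₂ (sub x) }

  d-++ˡ : (us : Vec C n) (vs : Vec C k) {cs : List C} → d us cs ≼ d (us ++ vs) cs
  d-++ˡ {k = k} us vs {cs} = subst (λ ws → d ws cs ≼ d (us ++ vs) cs) (select-tabulate (agree-↑ˡ {v = us} vs))
    (d-select (us ++ vs) (tabulate (_↑ˡ k)))

  d-zero : {vs : Vec C n} {cs : List C} → Allⱽ (λ v → d (v ∷ []) cs ≼ 0ᴿ) vs → d vs cs ≼ 0ᴿ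
  d-zero []                       = d-point (dfn-singleton [])
  d-zero {vs = v ∷ vs} (v∈ ∷ vs∈) = ≼-trans (d-∷-≤ v vs) (≼-trans (x+y≼x (d-zero vs∈)) (≼-trans (d-prefix vs) v∈))

  d-++-≤ : (us : Vec C n) (vs : Vec C k) {cs : List C} → d (us ++ vs) cs ≼ d us (toList vs ++ˡ cs) +ᴿ d vs cs
  d-++-≤ [] vs = ≼-trans (x≼x+y 0≼d) +ᴿ-comm
  d-++-≤ (u ∷ us) vs {cs} = ≼-trans (d-∷-≤ u (us ++ vs))
    (≼-trans (+ᴿ-mono (d-base (subst (λ ws → base (toList us ++ˡ toList vs ++ˡ cs) ⊆ base ws) (sym eq) id)) (d-++-≤ us vs))
      (≼-trans +ᴿ-assocˡ (+ᴿ-mono (d-∷-≥ u us) ≼-refl)))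
    where
    eq : toList (us ++ vs) ++ˡ cs ≡ toList us ++ˡ toList vs ++ˡ cs
    eq = trans (cong (_++ˡ cs) (Vec.toList-++ us vs)) (List.++-assoc (toList us) (toList vs) cs)

  d-++-≥ : (us : Vec C n) (vs : Vec C k) {cs : List C} → d us (toList vs ++ˡ cs) +ᴿ d vs cs ≼ d (us ++ vs) cs
  d-++-≥ [] vs = ≼-trans +ᴿ-comm (x+y≼x (d-zero []))
  d-++-≥ (u ∷ us) vs {cs} = ≼-trans (+ᴿ-mono (d-∷-≤ u us) ≼-refl) (≼-trans +ᴿ-assocʳ
    (≼-trans (+ᴿ-mono (d-base (subst (λ ws → base ws ⊆ base (toList us ++ˡ toList vs ++ˡ cs)) (sym eq) id)) (d-++-≥ us vs))
      (d-∷-≥ u (us ++ vs))))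
    where
    eq : toList (us ++ vs) ++ˡ cs ≡ toList us ++ˡ toList vs ++ˡ cs
    eq = trans (cong (_++ˡ cs) (Vec.toList-++ us vs)) (List.++-assoc (toList us) (toList vs) cs)

  -- This replaces images under definable maps: d(vs) ≤ d(vs , us) ≤ d(vs/us) + d(us), and the
  -- middle term on the right vanishes when each entry of `vs` has dimension zero over `us`.
  d-closure : (vs : Vec C n) (us : Vec C k) {cs : List C} →
              Allⱽ (λ v → d (v ∷ []) (toList us ++ˡ cs) ≼ 0ᴿ) vs → d vs cs ≼ d us cs
  d-closure vs us vs∈ = ≼-trans (d-++ˡ vs us) (≼-trans (d-++-≤ vs us)
    (≼-trans (+ᴿ-mono (d-zero vs∈) ≼-refl) (≼-trans +ᴿ-comm (x+y≼x ≼-refl))))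

  d-absorb : {us : Vec C n} {c : C} {cs : List C} → d (c ∷ []) cs ≼ 0ᴿ → d us cs ≼ d us (c ∷ cs)
  d-absorb {us = us} {c} c∈ = ≼-trans (d-++ˡ us (c ∷ [])) (≼-trans (d-++-≤ us (c ∷ [])) (x+y≼x c∈))

  -- Types over small sets and generic realizations

  infix 4 _~[_]_

  -- Equality of types over `A ∪ cs`. One inclusion is enough, because complements of definable sets
  -- are definable (`~-sym`).
  _~[_]_ : Vec C n → List C → Vec C n → Set ℓ
  us ~[ cs ] vs = ∀ D → Over F (base cs) D → ⟦ F ⟧ D us → ⟦ F ⟧ D vs

  ~-dfn : {us vs : Vec C n} {cs : List C} {S : Pred (Vec C n) ℓ} → us ~[ cs ] vs → Dfn (base cs) S → S us → S vs
  ~-dfn us~vs X s = proj₁ (define X) (us~vs (def X) (over X) (proj₂ (define X) s))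

  ~-sym : {us vs : Vec C n} {cs : List C} → us ~[ cs ] vs → vs ~[ cs ] us
  ~-sym us~vs D o vs∈ = by-contradiction λ us∉ → ~-dfn us~vs (dfn-¬ (dfn-Def {D = D} o)) us∉ vs∈

  ~-base : {us vs : Vec C n} {cs cs′ : List C} → base cs ⊆ base cs′ → us ~[ cs′ ] vs → us ~[ cs ] vs
  ~-base sub us~vs D o = us~vs D (Allⱽ.map sub o)

  ~-select : {us vs : Vec C n} {cs : List C} (σ : Vec (Fin n) k) → us ~[ cs ] vs → select us σ ~[ cs ] select vs σ
  ~-select σ us~vs D o = ~-dfn us~vs (dfn-select σ (dfn-Def {D = D} o))

  ~-d : {us vs : Vec C n} {cs : List C} → us ~[ cs ] vs → d vs cs ≼ d us cs
  ~-d us~vs = ⟨ (λ d<q → let D , o , us∈ , δ<q = d⁻ d<q in d⁺ D o (us~vs D o us∈) δ<q) ⟩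

  -- The rational q gives `δ E < q ≤ x`. Such sets are closed under unions, and a point outside all
  -- those over `A ∪ cs` has dimension at least `x`.
  Below : ℝ̄ ℓ → Def F n → Set ℓ
  Below x E = ∃[ q ] Above (δ E) q × ¬ Above x q

  below-∪ : {x : ℝ̄ ℓ} {E E′ G : Def F n} → Below x E → Below x E′ → ⟦ F ⟧ G ≐ ⟦ F ⟧ E ∪ ⟦ F ⟧ E′ → Below x G
  below-∪ {E = E} {E′} {G} (q , δ<q , ¬q) (r , δ<r , ¬r) e with ℚ.≤-total q r
  ... | inj₁ q≤r = r , proj₁ (union E E′ G e) (≤-Above (δ E) δ<q q≤r , δ<r) , ¬r
  ... | inj₂ r≤q = q , proj₁ (union E E′ G e) (δ<q , ≤-Above (δ E′) δ<r r≤q) , ¬q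

  ⋠⇒gap : {x y : ℝ̄ ℓ} → ¬ (x ≼ y) → ∃[ q ] Above y q × ¬ Above x q
  ⋠⇒gap x⋠y = by-contradiction λ ¬p → x⋠y ⟨ (λ {q} y<q → by-contradiction λ ¬x<q → ¬p (q , y<q , ¬x<q)) ⟩

  dfn-true : {n : ℕ} {cs : List C} → Dfn (base cs) {n} (λ _ → ¬ Poly.⊥ {ℓ})
  dfn-true = dfn-¬ (dfn-false)

  δ-empty : {cs : List C} {x : ℝ̄ ℓ} → ¬ (x ≼ 0ᴿ) → Below x (def (dfn-false {base cs} {n}))
  δ-empty {cs = cs} x⋠0 =
    let q , 0<q , ¬x<q = ⋠⇒gap x⋠0
        none = dfn-false {base cs}
    in q , proj₁ (finite (def none) ([] , λ {v} v∈ → Poly.⊥-elim (proj₁ (define none) {v} v∈))) 0<q , ¬x<q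

  -- Compactness for the sets `S i` minus the sets of dimension below `x`. None of these differences
  -- is empty, since `S i` has dimension at least `x`. If `x ≼ 0ᴿ` there is no set to remove, and
  -- any common point serves.
  generic-point : {cs : List C} {I : Set ℓ} (S : I → Pred (Vec C n) ℓ) (S-dfn : ∀ i → Dfn (base cs) (S i)) → I →
                  (∀ i j → Σ[ k ∈ I ] S k ⊆ S i ∩ S j) → (∀ i → Satisfiable (S i)) →
                  {x : ℝ̄ ℓ} → (∀ i → x ≼ δ (def (S-dfn i))) →
                  Σ[ v ∈ Vec C n ] (∀ i → S i v) × x ≼ d v cs
  generic-point {n} {cs} {I} S S-dfn i₀ directed S-sat {x} x≼δ = by-cases em
    where
    I⁺ : Set ℓ
    I⁺ = I × Σ[ E ∈ Def F n ] Over F (base cs) E × Below x E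
    T : I⁺ → Pred (Vec C n) ℓ
    T (i , (E , _)) v = S i v × ¬ ⟦ F ⟧ E v
    T-dfn : ∀ j → Dfn (base cs) (T j)
    T-dfn (i , (E , o , _)) = dfn-∩ (S-dfn i) (dfn-¬ (dfn-Def {D = E} o))
    T-sat : ∀ j → Satisfiable (T j)
    T-sat (i , (E , _ , (q , δ<q , ¬x<q))) = by-contradiction λ none →
      ¬x<q (≼⇒≤ᴿ (≼-trans (x≼δ i) (δ-mono {D = def (S-dfn i)} {E} (λ {v} v∈S →
        by-contradiction λ v∉E → none (v , proj₁ (define (S-dfn i)) v∈S , v∉E)))) δ<q)
    T-directed : ∀ i j → Σ[ k ∈ I⁺ ] T k ⊆ T i ∩ T j
    T-directed (i , (E , o , b)) (i′ , (E′ , o′ , b′)) =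
      let k , k⊆ = directed i i′
          Y = dfn-∪ (dfn-Def {D = E} o) (dfn-Def {D = E′} o′)
      in (k , (def Y , over Y , below-∪ {x = x} {E} {E′} {def Y} b b′ (define Y))) ,
         λ (s , ¬y) → (proj₁ (k⊆ s) , λ y → ¬y (proj₂ (define Y) (inj₁ y))) , (proj₂ (k⊆ s) , λ y → ¬y (proj₂ (define Y) (inj₂ y)))
    by-cases : Dec (x ≼ 0ᴿ) → Σ[ v ∈ Vec C n ] (∀ i → S i v) × x ≼ d v cs
    by-cases (yes x≼0) =
      let v , v∈ = compactness (base-small cs) S S-dfn i₀ directed S-sat in v , v∈ , ≼-trans x≼0 0≼d
    by-cases (no x⋠0) =
      let none : Dfn (base cs) {n} (λ _ → Poly.⊥)
          none = dfn-false
          j₀ : Σ[ E ∈ Def F n ] Over F (base cs) E × Below x E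
          j₀ = def none , over none , δ-empty {cs = cs} x⋠0
          v , v∈ = compactness (base-small cs) T T-dfn (i₀ , j₀) T-directed T-sat
      in v , (λ i → proj₁ (v∈ (i , j₀))) ,
         ⟨ (λ {r} d<r → let E , o , v∈E , δ<r = d⁻ d<r
                    in by-contradiction λ ¬x<r → proj₂ (v∈ (i₀ , (E , o , r , δ<r , ¬x<r))) v∈E) ⟩

  -- Existence of independent extensions: `generic-point` for all sets over `A ∪ cs` containing
  -- `us`, none of which has dimension below `d us cs`.
  generic-copy : (us : Vec C n) {cs cs′ : List C} → base cs ⊆ base cs′ →
                 Σ[ vs ∈ Vec C n ] us ~[ cs ] vs × d us cs ≼ d vs cs′
  generic-copy {n} us {cs} {cs′} sub =
    let vs , vs∈ , generic = generic-point S S-dfn i₀ directed (λ (D , o , us∈) → us , us∈) {d us cs}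
                               (λ (D , o , us∈) → d≼δ (dfn-Def {D = D} o) us∈)
    in vs , (λ D o us∈ → vs∈ (D , o , us∈)) , generic
    where
    I : Set ℓ
    I = Σ[ D ∈ Def F n ] Over F (base cs) D × ⟦ F ⟧ D us
    S : I → Pred (Vec C n) ℓ
    S (D , _) = ⟦ F ⟧ D
    S-dfn : ∀ i → Dfn (base cs′) (S i)
    S-dfn (D , o , _) = dfn-⊆ sub (dfn-Def {D = D} o)
    directed : ∀ i j → Σ[ k ∈ I ] S k ⊆ S i ∩ S j
    directed (D , o , us∈) (D′ , o′ , us∈′) =
      let X = dfn-∩ (dfn-Def {D = D} o) (dfn-Def {D = D′} o′)
      in (def X , over X , proj₂ (define X) (us∈ , us∈′)) , proj₁ (define X)
    i₀ : I
    i₀ = def (dfn-true {cs = cs}) , over (dfn-true {n} {cs}) , proj₂ (define (dfn-true {cs = cs})) {us} (λ ())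

  -- Each formula satisfied by `w ∷ us` contributes its existential closure to the type of `us`,
  -- hence to that of `vs`. Compactness over `vs` combines the witnesses.
  homogeneity : {us vs : Vec C n} {cs : List C} → us ~[ cs ] vs → ∀ w → Σ[ w′ ∈ C ] (w ∷ us) ~[ cs ] (w′ ∷ vs)
  homogeneity {n} {us} {vs} {cs} us~vs w =
    realised (compactness (base-small (toList vs ++ˡ cs)) S S-dfn i₀ directed S-sat)
    where
    I : Set ℓ
    I = Σ[ D ∈ Def F (suc n) ] Over F (base cs) D × ⟦ F ⟧ D (w ∷ us)
    S : I → Pred (Vec C 1) ℓ
    S (D , _) = ⟦ F ⟧ (at-params D vs)
    S-dfn : ∀ i → Dfn (base (toList vs ++ˡ cs)) (S i)
    S-dfn (D , o , _) = dfn-Def {D = at-params D vs} (over-at {cs = cs} D vs o)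
    S-sat : ∀ i → Satisfiable (S i)
    S-sat (D , o , ∈D) =
      let x , x∈ = ~-dfn us~vs (dfn-∃ (dfn-Def {D = D} o)) (w , ∈D) in x ∷ [] , x∈
    directed : ∀ i j → Σ[ k ∈ I ] S k ⊆ S i ∩ S j
    directed (D , o , ∈D) (D′ , o′ , ∈D′) =
      let X = dfn-∩ (dfn-Def {D = D} o) (dfn-Def {D = D′} o′)
      in (def X , over X , proj₂ (define X) (∈D , ∈D′)) , λ { {x ∷ []} x∈ → proj₁ (define X) {x ∷ vs} x∈ }
    i₀ : I
    i₀ = def (dfn-true {cs = cs}) , over (dfn-true {suc n} {cs}) , proj₂ (define (dfn-true {cs = cs})) {w ∷ us} (λ ())
    realised : Satisfiable (λ v → ∀ i → S i v) → Σ[ w′ ∈ C ] (w ∷ us) ~[ cs ] (w′ ∷ vs)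
    realised (w′ ∷ [] , w∈) = w′ , λ D o ∈D → w∈ (D , o , ∈D)

-- Field operations and dimension inequalities for sums

module FieldCalculus (em : ∀ {a} → ExcludedMiddle a) {ℓ : Level} {L : Language ℓ} (R : RingSymbols L) (F : Structure L)
  (isField : FieldOps.IsField R F) (dim : Dimension F)
  (κ : Set ℓ) (ℕ≺κ : U {A = ℕ} ≺ κ) (saturated : Saturated F κ) (A : Subset F) (A≺κ : A ≺ κ) where

  open Classical em public
  open Calculus em F dim κ ℕ≺κ saturated A A≺κ public
  open Structure F renaming (Carrier to C) using () public
  open RingSymbols R renaming (zero to zeroˢ; one to oneˢ)
  open FieldOps R F
  open FieldOps.IsField isField public

  commutativeRing : CommutativeRing ℓ ℓ
  commutativeRing = record { isCommutativeRing = isCommutativeRing }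

  module 𝔽 = CommutativeRing commutativeRing
  module 𝔽P = RingProperties 𝔽.ring
  open SemiringSolver 𝔽.commutativeSemiring public using (solve; _:+_; _:*_; _:=_)

  private variable
    us vs : Vec C n
    x y z : C
    cs cs′ : List C

  *-cancelˡ : x ≢ 0# → x * y ≡ x * z → y ≡ z
  *-cancelˡ {x} {y} {z} x≢0 e = let x⁻¹ , xx⁻¹ = inverse x x≢0 in begin
    y              ≡⟨ undo x⁻¹ xx⁻¹ y ⟨
    x⁻¹ * (x * y)  ≡⟨ cong (x⁻¹ *_) e ⟩
    x⁻¹ * (x * z)  ≡⟨ undo x⁻¹ xx⁻¹ z ⟩
    z              ∎
    where
    open ≡-Reasoning
    undo : ∀ i → x * i ≡ 1# → ∀ w → i * (x * w) ≡ w
    undo i xi w = trans (sym (𝔽.*-assoc i x w)) (trans (cong (_* w) (trans (𝔽.*-comm i x) xi)) (𝔽.*-identityˡ w))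

  +-cancelˡ : x + y ≡ x + z → y ≡ z
  +-cancelˡ {x} {y} {z} = 𝔽P.+-cancelˡ x y z

  -- Elements of dimension zero over cs play the role of the definable closure of cs.
  infix 4 _∈cl_

  _∈cl_ : C → List C → Set ℓ
  x ∈cl cs = d (x ∷ []) cs ≼ 0ᴿ

  cl-∈ : x ∈ˡ cs → x ∈cl cs
  cl-∈ x∈ = d-base-point (inj₂ x∈)

  cl-here : x ∈cl (x ∷ cs)
  cl-here = cl-∈ (here refl)

  cl-there : x ∈cl cs → x ∈cl (y ∷ cs)
  cl-there = ≼-trans d-drop

  cl-⊆ : (∀ {z} → z ∈ˡ cs → z ∈ˡ cs′) → x ∈cl cs → x ∈cl cs′
  cl-⊆ sub = ≼-trans (d-⊆ sub)

  -- Covers both operations and their inverses, since `z` may occur on either side of the equation.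
  -- Adjoining `x` and `y` to the parameters costs nothing, and over them `z` is the only solution.
  cl-dfn : (s t : Term L 3) → eval F (x ∷ y ∷ z ∷ []) s ≡ eval F (x ∷ y ∷ z ∷ []) t →
           (∀ w → eval F (x ∷ y ∷ w ∷ []) s ≡ eval F (x ∷ y ∷ w ∷ []) t → w ≡ z) →
           x ∈cl cs → y ∈cl cs → z ∈cl cs
  cl-dfn {x} {y} {z} s t e unique x∈ y∈ =
    d-absorb x∈ ⟫ d-absorb (cl-there y∈) ⟫ d-⊆ sub ⟫ d-point point
    where
    sub : ∀ {z} → z ∈ˡ y ∷ x ∷ [] → z ∈ˡ y ∷ x ∷ _
    sub (here e)          = here e
    sub (there (here e))  = there (here e)
    point : Dfn (base (y ∷ x ∷ [])) (_≡ z ∷ [])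
    point = dfn-≐ ((λ { {w ∷ []} e → cong (_∷ []) (unique w e) }) , (λ { refl → e }))
      (dfn-inst (inj₂ (here refl)) (dfn-inst (inj₂ (there (here refl))) (dfn-≈ s t)))

  private
    v₀ v₁ v₂ : Term L 3
    v₀ = var (# 0)
    v₁ = var (# 1)
    v₂ = var (# 2)

  cl-+ : x ∈cl cs → y ∈cl cs → x + y ∈cl cs
  cl-+ = cl-dfn v₂ (fun add (v₀ ∷ v₁ ∷ [])) refl (λ _ → id)

  cl-* : x ∈cl cs → y ∈cl cs → x * y ∈cl cs
  cl-* = cl-dfn v₂ (fun mul (v₀ ∷ v₁ ∷ [])) refl (λ _ → id)

  cl-+⁻ : x ∈cl cs → x + y ∈cl cs → y ∈cl cs
  cl-+⁻ = cl-dfn v₁ (fun add (v₀ ∷ v₂ ∷ [])) refl (λ _ e → sym (+-cancelˡ e))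

  cl-*⁻ : x ≢ 0# → x ∈cl cs → x * y ∈cl cs → y ∈cl cs
  cl-*⁻ x≢0 = cl-dfn v₁ (fun mul (v₀ ∷ v₂ ∷ [])) refl (λ _ e → sym (*-cancelˡ x≢0 e))

  cl-0 : 0# ∈cl cs
  cl-0 = d-point (dfn-≐ ((λ { {w ∷ []} refl → refl }) , (λ { refl → refl })) (dfn-≈ (var (# 0)) (fun zeroˢ [])))

  cl-1 : 1# ∈cl cs
  cl-1 = d-point (dfn-≐ ((λ { {w ∷ []} refl → refl }) , (λ { refl → refl })) (dfn-≈ (var (# 0)) (fun oneˢ [])))

  cl-neg : x ∈cl cs → - x ∈cl cs
  cl-neg {x} {cs} x∈ = cl-+⁻ x∈ (subst (_∈cl cs) (sym (𝔽.-‿inverseʳ x)) cl-0)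

  -- Generic elements are chosen over given elements, whereas the inequalities for sums ask for
  -- genericity over sums and products computed from them. The computed ones can be adjoined at no
  -- cost.
  d-rebase : (hs : Vec C k) → Allⱽ (_∈cl cs′) hs → (∀ {z} → z ∈ˡ cs → z ∈ˡ cs′) →
             d us cs′ ≼ d us (toList hs ++ˡ cs)
  d-rebase {cs′ = cs′} {cs = cs} {us = us} hs hs∈ sub = adjoin hs hs∈ ⟫ d-⊆ (sub-++ (toList hs))
    where
    adjoin : ∀ {j} (gs : Vec C j) → Allⱽ (_∈cl cs′) gs → d us cs′ ≼ d us (toList gs ++ˡ cs′)
    adjoin []       []        = ≼-refl
    adjoin (g ∷ gs) (g∈ ∷ gs∈) = adjoin gs gs∈ ⟫ d-absorb (d-prefix gs ⟫ g∈)
    sub-++ : ∀ gs {z} → z ∈ˡ gs ++ˡ cs → z ∈ˡ gs ++ˡ cs′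
    sub-++ []       z∈         = sub z∈
    sub-++ (g ∷ gs) (here e)   = here e
    sub-++ (g ∷ gs) (there z∈) = there (sub-++ gs z∈)

  d-transfer : (hs : Vec C k) → x ∈cl (y ∷ cs′) → Allⱽ (_∈cl cs′) hs → (∀ {z} → z ∈ˡ cs → z ∈ˡ cs′) →
               d (x ∷ []) cs′ ≼ d (y ∷ []) (toList hs ++ˡ cs)
  d-transfer {y = y} hs x∈ hs∈ sub = d-closure (_ ∷ []) (y ∷ []) (x∈ ∷ []) ⟫ d-rebase hs hs∈ sub

  -- Ruzsa's triangle inequality: the fibres of (u + r , v + r) ↦ u − v have the dimension of r.
  ruzsa : {e : ℝ̄ ℓ} → Finite⁺ e → {u v w r : C} → v + w ≡ u →
          e ≼ d (r ∷ []) (u ∷ v ∷ cs) → d (u + r ∷ []) cs ≼ e → d (v + r ∷ []) cs ≼ e → d (w ∷ []) cs ≼ e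
  ruzsa {cs} {e} e-finite {u} {v} {w} {r} v+w≡u r-generic u+r≼ v+r≼ = +ᴿ-cancelˡ e-finite
    (+ᴿ-mono (r-generic ⟫ d-transfer (w ∷ []) r∈ (w∈ ∷ []) (λ z∈ → there (there z∈))) ≼-refl
     ⟫ d-∷-≥ (u + r) (w ∷ [])
     ⟫ d-closure (u + r ∷ w ∷ []) (u + r ∷ v + r ∷ [])
         (cl-here ∷ cl-+⁻ (cl-there cl-here) (subst (_∈cl (u + r ∷ v + r ∷ cs)) (sym shift) cl-here) ∷ [])
     ⟫ d-∷-≤ (u + r) (v + r ∷ [])
     ⟫ +ᴿ-mono (d-drop ⟫ u+r≼) v+r≼)
    where
    shift : (v + r) + w ≡ u + r
    shift = trans (solve 3 (λ v r w → (v :+ r) :+ w := (v :+ w) :+ r) refl v r w) (cong (_+ r) v+w≡u)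
    r∈ : r ∈cl (u + r ∷ u ∷ v ∷ cs)
    r∈ = cl-+⁻ (cl-there cl-here) cl-here
    w∈ : w ∈cl (u ∷ v ∷ cs)
    w∈ = cl-+⁻ (cl-there cl-here) (subst (_∈cl (u ∷ v ∷ cs)) (sym v+w≡u) cl-here)

  -- Submodularity, applied to (x , z) over x + y + z.
  triple-sum : {e : ℝ̄ ℓ} → Finite⁺ e → {x y z : C} → Finite⁺ (d (x ∷ []) cs) → Finite⁺ (d (z ∷ []) cs) →
               e ≼ d (y ∷ []) (x ∷ z ∷ cs) → d (x ∷ []) cs ≼ d (x ∷ []) (z ∷ cs) →
               d (x + y ∷ []) cs ≼ e → d (y + z ∷ []) cs ≼ e → d ((x + y) + z ∷ []) cs ≼ e
  triple-sum {cs} {e} e-finite {x} {y} {z} x-finite z-finite y-generic x-generic x+y≼ y+z≼ =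
    -- d(s) is added on both sides, so that one copy joins d(x/s) to form d(x , s) and the other
    -- joins d(z/s) to form d(z , s). These are at most d(x) + e and d(z) + e; cancelling e + d(x) +
    -- d(z) leaves d(s) ≤ e.
    +ᴿ-cancelˡ (finite-+ e-finite (finite-+ x-finite z-finite))
      (+ᴿ-mono below ≼-refl ⟫ +ᴿ-mono above ≼-refl ⟫ +ᴿ-comm ⟫ +ᴿ-assocˡ ⟫ +ᴿ-mono +ᴿ-comm ≼-refl
       ⟫ +ᴿ-mono (d-∷-≥ x (s ∷ []) ⟫ x,s) (d-∷-≥ z (s ∷ []) ⟫ z,s) 
       ⟫ +ᴿ-assocˡ ⟫ +ᴿ-mono (+ᴿ-mono +ᴿ-comm ≼-refl ⟫ +ᴿ-assocʳ) ≼-refl)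
    where
    s = (x + y) + z
    below : e +ᴿ (d (x ∷ []) cs +ᴿ d (z ∷ []) cs) ≼ d (y ∷ x ∷ z ∷ []) cs
    below = +ᴿ-mono y-generic (+ᴿ-mono x-generic ≼-refl ⟫ d-∷-≥ x (z ∷ [])) ⟫ d-∷-≥ y (x ∷ z ∷ [])
    s∈ : {ds : List C} → s ∈cl ds → z ∈cl ds → x + y ∈cl ds
    s∈ {ds} s∈ z∈ = cl-+⁻ z∈ (subst (_∈cl ds) (𝔽.+-comm (x + y) z) s∈)
    above : d (y ∷ x ∷ z ∷ []) cs ≼ d (x ∷ []) (s ∷ cs) +ᴿ (d (z ∷ []) (s ∷ cs) +ᴿ d (s ∷ []) cs)
    above = d-closure (y ∷ x ∷ z ∷ []) (x ∷ z ∷ s ∷ [])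
              (cl-+⁻ cl-here (s∈ (cl-there (cl-there cl-here)) (cl-there cl-here)) ∷ cl-here ∷ cl-there cl-here ∷ [])
      ⟫ d-∷-≤ x (z ∷ s ∷ []) ⟫ +ᴿ-mono d-drop (d-∷-≤ z (s ∷ []))
    x,s : d (x ∷ s ∷ []) cs ≼ d (x ∷ []) cs +ᴿ e
    x,s = d-closure (x ∷ s ∷ []) (x ∷ y + z ∷ [])
            (cl-here ∷ subst (_∈cl (x ∷ y + z ∷ cs)) (sym (𝔽.+-assoc x y z)) (cl-+ cl-here (cl-there cl-here)) ∷ [])
      ⟫ d-∷-≤ x (y + z ∷ []) ⟫ +ᴿ-mono d-drop y+z≼
    z,s : d (z ∷ s ∷ []) cs ≼ d (z ∷ []) cs +ᴿ e
    z,s = d-closure (z ∷ s ∷ []) (z ∷ x + y ∷ []) (cl-here ∷ cl-+ (cl-there cl-here) cl-here ∷ [])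
      ⟫ d-∷-≤ z (x + y ∷ []) ⟫ +ᴿ-mono d-drop x+y≼

-- Realizations of the generic type

module GenericType (em : ∀ {a} → ExcludedMiddle a) {ℓ : Level} {L : Language ℓ} (R : RingSymbols L) (F : Structure L)
  (isField : FieldOps.IsField R F) (dim : Dimension F)
  (κ : Set ℓ) (ℕ≺κ : U {A = ℕ} ≺ κ) (saturated : Saturated F κ) (A : Subset F) (A≺κ : A ≺ κ)
  (p : Pred (Def F 1) ℓ) (p-complete : CompleteType F A p)
  (X : Subset F) (P⊆X : Realizations₁ F p ⊆ X)
  (e : ℝ̄ ℓ) (e-finite : Finite⁺ e) (e-positive : ¬ e ≼ 0ᴿ)
  (δP≼e : δ* F dim (Realizations₁ F p) ≼ e) (e≼δP : e ≼ δ* F dim (Realizations₁ F p))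
  (X⊕X≼e : δ* F dim (FieldOps._⊕_ R F X X) ≼ e) (X⊗X≼e : δ* F dim (FieldOps._⊗_ R F X X) ≼ e) where

  open FieldCalculus em R F isField dim κ ℕ≺κ saturated A A≺κ
  open RingSymbols R renaming (zero to zeroˢ; one to oneˢ)
  open FieldOps R F
  open Dimension dim using (δ; finite)

  P : Subset F
  P = Realizations₁ F p

  private variable
    us vs : Vec C n
    a b c x y z : C
    cs cs′ : List C

  P-~ : {us vs : Vec C n} (i : Fin n) → us ~[ cs ] vs → P (lookup us i) → P (lookup vs i)
  P-~ i us~vs Pu D D∈p =
    ~-dfn us~vs (dfn-select (i ∷ []) (dfn-Def {D = D} (Allⱽ.map inj₁ (proj₁ (proj₁ p-complete) D∈p)))) (Pu D D∈p)

  P-satisfiable : Satisfiable P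
  P-satisfiable = point (saturated A p A≺κ (proj₁ p-complete))
    where
    point : Satisfiable (Realizations F p) → Satisfiable P
    point (x ∷ [] , Px) = x , Px

  base[]⊆A : base [] ⊆ A
  base[]⊆A (inj₁ x∈A) = x∈A

  P⊆ : (D : Def F 1) → Over F (base []) D → P a → ⟦ F ⟧ D (a ∷ []) → P ⊆ ⟦_⟧₁ F D
  P⊆ D o Pa a∈D with proj₂ p-complete D (Allⱽ.map base[]⊆A o)
  ... | inj₁ D∈p  = λ Pb → Pb D D∈p
  ... | inj₂ ¬D∈p = Poly.⊥-elim (Pa (negate F D) ¬D∈p a∈D)

  -- By completeness of p, a set over `A` containing one realization contains all of `P`, and so
  -- takes part in the infimum that defines δ(P).
  e≼d : P a → e ≼ d (a ∷ []) []
  e≼d Pa = ⟨ (λ d<q → let D , o , a∈D , δ<q = d⁻ d<q in ≼⇒≤ᴿ e≼δP ((D , P⊆ D o Pa a∈D) , δ<q)) ⟩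

  -- The sets D ⊇ Q need not be over A: a copy of x generic over the parameters of D lies in D.
  d≼-invariant : (Q : Subset F) → δ* F dim Q ≼ e → (∀ z → x ∷ [] ~[ [] ] z ∷ [] → Q z) → d (x ∷ []) [] ≼ e
  d≼-invariant {x} Q Q≼e invariant = ⟨ (λ e<q →
    let (D , Q⊆D) , δ<q = ≼⇒≤ᴿ Q≼e e<q
    in bound-by D Q⊆D δ<q (generic-copy (x ∷ []) {[]} {toList (params D)} (λ { (inj₁ x) → inj₁ x }))) ⟩
    where
    bound-by : ∀ {q} (D : Def F 1) → Q ⊆ ⟦_⟧₁ F D → Above (δ D) q →
               Σ[ vs ∈ Vec C 1 ] x ∷ [] ~[ [] ] vs × d (x ∷ []) [] ≼ d vs (toList (params D)) → Above (d (x ∷ []) []) q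
    bound-by D Q⊆D δ<q (z ∷ [] , x~z , generic) = ≼⇒≤ᴿ generic
      (d⁺ D (Allⱽ.lookup⁻ (λ i → inj₂ (∈ⱽ.∈-toList⁺ (∈ⱽ.∈-lookup i (params D))))) (Q⊆D (invariant z x~z)) δ<q)

  d≼e : P a → d (a ∷ []) cs ≼ e
  d≼e Pa = d-⊆ {cs = []} (λ ()) ⟫ d≼-invariant P δP≼e (λ z a~z → P-~ zero a~z Pa)

  -- Any `z` with the type of f(a , b) over `A` is itself f(a′ , b′) with a′ and b′ realizing p, by
  -- homogeneity. This is the invariance that `d≼-invariant` asks for.
  operation≼e : (f : Language.Fun L 2) (Q : Subset F) → δ* F dim Q ≼ e →
                (∀ {x y} → X x → X y → Q (Structure.⟦fun⟧ F f (x ∷ y ∷ []))) →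
                P a → P b → d (Structure.⟦fun⟧ F f (a ∷ b ∷ []) ∷ []) [] ≼ e
  operation≼e {a} {b} f Q Q≼e closed Pa Pb = d≼-invariant Q Q≼e λ z s~z →
    let b′ , s~ = homogeneity s~z b
        a′ , s~ = homogeneity s~ a
        z≡ = ~-dfn s~ (dfn-≈ (var (# 2)) (fun f (var (# 0) ∷ var (# 1) ∷ []))) refl
    in subst Q (sym z≡) (closed (P⊆X (P-~ (# 0) s~ Pa)) (P⊆X (P-~ (# 1) s~ Pb)))

  +≼e : P a → P b → d (a + b ∷ []) [] ≼ e
  +≼e = operation≼e add (X ⊕ X) X⊕X≼e λ Xx Xy → _ , _ , Xx , Xy , refl

  *≼e : P a → P b → d (a * b ∷ []) [] ≼ e
  *≼e = operation≼e mul (X ⊗ X) X⊗X≼e λ Xx Xy → _ , _ , Xx , Xy , refl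

  generic : ∀ cs → ∃[ b ] P b × e ≼ d (b ∷ []) cs
  generic cs = let a , Pa = P-satisfiable in
    copy Pa (generic-copy (a ∷ []) {[]} {cs} (λ { (inj₁ x) → inj₁ x }))
    where
    copy : P a → Σ[ vs ∈ Vec C 1 ] a ∷ [] ~[ [] ] vs × d (a ∷ []) [] ≼ d vs cs → ∃[ b ] P b × e ≼ d (b ∷ []) cs
    copy Pa (b ∷ [] , a~b , a≼b) = b , P-~ zero a~b Pa , e≼d Pa ⟫ a≼b

  generic∉cl : e ≼ d (b ∷ []) cs → ¬ b ∈cl cs
  generic∉cl b-generic b∈ = e-positive (b-generic ⟫ b∈)

  P≢0 : P a → a ≢ 0#
  P≢0 Pa refl = generic∉cl (e≼d Pa) cl-0

  d-finite : d us cs ≼ e → Finite⁺ (d us cs)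
  d-finite ⟨ d≤e ⟩ = finite⁺ 0≼d (let q , e<q = bound e-finite in q , d≤e e<q)

  -- δ(p + xp) ≤ e, uniformly over A ∪ cs.
  Good : List C → C → Set ℓ
  Good cs x = x ∈cl cs × (∀ {a b} → P a → P b → d (a + x * b ∷ []) cs ≼ e)

  good-⊆ : (∀ {z} → z ∈ˡ cs → z ∈ˡ cs′) → Good cs x → Good cs′ x
  good-⊆ sub (x∈ , x≼) = cl-⊆ sub x∈ , λ Pa Pb → d-⊆ sub ⟫ x≼ Pa Pb

  d-≡ : x ≡ y → d (x ∷ []) cs ≼ e → d (y ∷ []) cs ≼ e
  d-≡ refl x≼ = x≼

  good-0 : Good [] 0#
  good-0 = cl-0 , λ {a} {b} Pa Pb → d-≡ (sym (trans (cong (a +_) (𝔽.zeroˡ b)) (𝔽.+-identityʳ a))) (d≼e Pa)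

  good-1 : Good [] 1#
  good-1 = cl-1 , λ {a} {b} Pa Pb → d-≡ (cong (a +_) (sym (𝔽.*-identityˡ b))) (+≼e Pa Pb)

  -- Ruzsa's inequality subtracts, so -xy comes before negation and products. With u = a, v = xyc
  -- and r = xb for generic b, the two sums are a + xb and x(b + yc), controlled by x and by y. The
  -- shift xb is generic only for x ≠ 0; if x = 0, then z = 0 too.
  good-negated-product : Good cs x → Good cs y → z + x * y ≡ 0# → Good cs z
  good-negated-product {cs} {x} {y} {z} (x∈ , x≼) (y∈ , y≼) z+xy≡0 =
    cl-+⁻ (cl-* x∈ y∈) (subst (_∈cl cs) (trans (sym z+xy≡0) (𝔽.+-comm z (x * y))) cl-0) , λ {a} {c} → by-cases em
    where
    by-cases : Dec (x ≡ 0#) → P a → P c → d (a + z * c ∷ []) cs ≼ e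
    by-cases {a} {c} (yes x≡0) Pa Pc = d-≡ (sym (trans (cong (λ z → a + z * c) z≡0)
      (trans (cong (a +_) (𝔽.zeroˡ c)) (𝔽.+-identityʳ a)))) (d≼e Pa)
      where
      z≡0 : z ≡ 0#
      z≡0 = trans (sym (𝔽.+-identityʳ z)) (trans (cong (z +_) (sym (trans (cong (_* y) x≡0) (𝔽.zeroˡ y)))) z+xy≡0)
    by-cases {a} {c} (no x≢0) Pa Pc =
      let b , Pb , b-generic = generic (a ∷ x * y * c ∷ cs)
      in ruzsa e-finite split
           (b-generic ⟫ d-closure (b ∷ []) (x * b ∷ []) (cl-*⁻ x≢0 (cl-there (cl-there (cl-there x∈))) cl-here ∷ []))
           (x≼ Pa Pb)
           (d-closure (x * y * c + x * b ∷ []) (b + y * c ∷ [])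
             (subst (_∈cl (b + y * c ∷ cs))
               (solve 4 (λ x y b c → x :* (b :+ y :* c) := x :* y :* c :+ x :* b) refl x y b c)
               (cl-* (cl-there x∈) cl-here) ∷ [])
            ⟫ y≼ Pb Pc)
      where
      split : x * y * c + (a + z * c) ≡ a
      split = trans (solve 5 (λ x y z a c → x :* y :* c :+ (a :+ z :* c) := a :+ (z :+ x :* y) :* c) refl x y z a c)
        (trans (cong (λ w → a + w * c) z+xy≡0) (trans (cong (a +_) (𝔽.zeroˡ c)) (𝔽.+-identityʳ a)))

  good-neg : Good cs x → Good cs (- x)
  good-neg {x = x} x-good = good-negated-product (good-⊆ (λ ()) good-1) x-good
    (trans (cong (- x +_) (𝔽.*-identityˡ x)) (𝔽.-‿inverseˡ x))

  good-* : Good cs x → Good cs y → Good cs (x * y)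
  good-* {x = x} {y} x-good y-good = good-negated-product (good-⊆ (λ ()) good-1)
    (good-negated-product x-good y-good (𝔽.-‿inverseˡ (x * y)))
    (trans (cong (x * y +_) (𝔽.*-identityˡ (- (x * y)))) (𝔽.-‿inverseʳ (x * y)))

  good-inverse : x * y ≡ 1# → Good cs x → Good cs y
  good-inverse {x} {y} {cs} xy≡1 (x∈ , x≼) = y∈ , λ {a} {b} Pa Pb →
    d-closure (a + y * b ∷ []) (b + x * a ∷ [])
      (subst (_∈cl (b + x * a ∷ cs)) (scale a b) (cl-* (cl-there y∈) cl-here) ∷ []) ⟫ x≼ Pb Pa
    where
    x≢0 : x ≢ 0#
    x≢0 refl = nontrivial (trans (sym xy≡1) (𝔽.zeroˡ y))
    y∈ : y ∈cl cs
    y∈ = cl-*⁻ x≢0 x∈ (subst (_∈cl cs) (sym xy≡1) cl-1)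
    scale : ∀ a b → y * (b + x * a) ≡ a + y * b
    scale a b = trans (solve 4 (λ x y a b → y :* (b :+ x :* a) := x :* y :* a :+ y :* b) refl x y a b)
      (cong (_+ y * b) (trans (cong (_* a) xy≡1) (𝔽.*-identityˡ a)))

  -- Ruzsa's inequality with u = xb + yb, v = -a and r = f + g, for independent generic f and g. As
  -- xb and yb both depend on b, submodularity cannot be applied to them directly; adding f makes xb
  -- + f independent of yb. Then `triple-sum` bounds f + g + xb, next (xb + f) + g + yb, and
  -- likewise f + g - a.
  good-+ : Good cs x → Good cs y → Good cs (x + y)
  good-+ {cs} {x} {y} x-good@(x∈ , x≼) y-good@(y∈ , y≼) = cl-+ x∈ y∈ , sum
    where
    m = - 1#
    m-good : Good cs m
    m-good = good-neg (good-⊆ (λ ()) good-1)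

    scaled≼e : Good cs z → P b → d (z * b ∷ []) cs ≼ e
    scaled≼e {z} {b} (z∈ , _) Pb = d-closure (z * b ∷ []) (b ∷ []) (cl-* (cl-there z∈) cl-here ∷ []) ⟫ d≼e Pb

    two-generics : ∀ {f g} → Good cs z → P b → P f → P g → e ≼ d (f ∷ []) (z * b ∷ cs) → e ≼ d (g ∷ []) (f ∷ z * b ∷ cs) →
                   d ((f + g) + z * b ∷ []) cs ≼ e
    two-generics z-good Pb Pf Pg f-generic g-generic = triple-sum e-finite
      (d-finite (d≼e Pf)) (d-finite (scaled≼e z-good Pb)) g-generic (d≼e Pf ⟫ f-generic)
      (d-⊆ (λ ()) ⟫ +≼e Pf Pg) (proj₂ z-good Pg Pb)

    sum : ∀ {a b} → P a → P b → d (a + (x + y) * b ∷ []) cs ≼ e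
    sum {a} {b} Pa Pb =
      let f , Pf , f-generic = generic (a ∷ b ∷ cs)
          g , Pg , g-generic = generic (f ∷ a ∷ b ∷ cs)
          scaled∈ : ∀ {z ds} → Good cs z → z * b ∈cl (ds ++ˡ a ∷ b ∷ cs)
          scaled∈ = λ {z} {ds} z-good → cl-⊆ (∈ˡ.∈-++⁺ʳ ds)
            (cl-* (cl-there (cl-there (proj₁ z-good))) (cl-there cl-here))
          ma∈ : ∀ {ds} → m * a ∈cl (ds ++ˡ a ∷ b ∷ cs)
          ma∈ = λ {ds} → cl-⊆ (∈ˡ.∈-++⁺ʳ ds) (cl-* (cl-there (cl-there (proj₁ m-good))) cl-here)
          sub₂ : ∀ {z} → z ∈ˡ cs → z ∈ˡ a ∷ b ∷ cs
          sub₂ = λ z∈ → there (there z∈)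
          sub₃ : ∀ {z} → z ∈ˡ cs → z ∈ˡ f ∷ a ∷ b ∷ cs
          sub₃ = λ z∈ → there (there (there z∈))
          one = two-generics x-good Pb Pf Pg
                  (f-generic ⟫ d-rebase (x * b ∷ []) (scaled∈ {ds = []} x-good ∷ []) sub₂)
                  (g-generic ⟫ d-rebase (f ∷ x * b ∷ []) (cl-here ∷ scaled∈ {ds = f ∷ []} x-good ∷ []) sub₃)
          minus = two-generics m-good Pa Pf Pg
                    (f-generic ⟫ d-rebase (m * a ∷ []) (ma∈ {[]} ∷ []) sub₂)
                    (g-generic ⟫ d-rebase (f ∷ m * a ∷ []) (cl-here ∷ ma∈ {f ∷ []} ∷ []) sub₃)
          xb+f≼e = d-≡ (𝔽.+-comm f (x * b)) (x≼ Pf Pb)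
          both = triple-sum e-finite (d-finite xb+f≼e) (d-finite (scaled≼e y-good Pb))
                   (g-generic ⟫ d-rebase (x * b + f ∷ y * b ∷ [])
                     (cl-+ (scaled∈ {ds = f ∷ []} x-good) cl-here ∷ scaled∈ {ds = f ∷ []} y-good ∷ []) sub₃)
                   (xb+f≼e ⟫ f-generic ⟫ d-transfer (y * b ∷ [])
                     (cl-+⁻ (scaled∈ {ds = _ ∷ []} x-good) cl-here) (scaled∈ {ds = []} y-good ∷ []) sub₂)
                   (d-≡ (solve 3 (λ f g z → (f :+ g) :+ z := (z :+ f) :+ g) refl f g (x * b)) one)
                   (y≼ Pg Pb)
      in ruzsa e-finite {u = x * b + y * b} {v = m * a} {r = f + g}
           (trans (solve 5 (λ x y b m a → m :* a :+ (a :+ (x :+ y) :* b) := (m :* a :+ a) :+ (x :* b :+ y :* b)) refl x y b m a)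
             (trans (cong (_+ (x * b + y * b)) ma+a≡0) (𝔽.+-identityˡ _)))
           (g-generic ⟫ d-transfer (x * b + y * b ∷ m * a ∷ []) (cl-+⁻ (cl-there cl-here) cl-here)
             (cl-+ (scaled∈ {ds = f ∷ []} x-good) (scaled∈ {ds = f ∷ []} y-good) ∷ ma∈ {f ∷ []} ∷ []) sub₃)
           (d-≡ (solve 4 (λ u f g v → ((u :+ f) :+ g) :+ v := (u :+ v) :+ (f :+ g)) refl (x * b) f g (y * b)) both)
           (d-≡ (𝔽.+-comm (f + g) (m * a)) minus)
      where
      ma+a≡0 : m * a + a ≡ 0#
      ma+a≡0 = trans (cong (m * a +_) (sym (𝔽.*-identityˡ a)))
        (trans (sym (𝔽.distribʳ a m 1#)) (trans (cong (_* a) (𝔽.-‿inverseˡ 1#)) (𝔽.zeroˡ a)))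

  base-⊆ : (∀ {z} → z ∈ˡ cs → z ∈ˡ cs′) → base cs ⊆ base cs′
  base-⊆ sub (inj₁ x∈) = inj₁ x∈
  base-⊆ sub (inj₂ x∈) = inj₂ (sub x∈)

  -- a and a′ are linked by a generic element of ap ∩ a′p.
  record Linked (a a′ : C) : Set ℓ where
    field
      r r′  : C
      Pr    : P r
      Pr′   : P r′
      ar≡   : a * r ≡ a′ * r′
      large : e +ᴿ e ≼ d (r ∷ a′ ∷ []) (a ∷ [])

  -- For c generic over a, the pair (a , c) has dimension 2e and ac at most e, so the fibre over ac
  -- has dimension at least e. In a generic copy (a′ , c′) over ac, the element c′ is ac/a′, hence
  -- a′ alone carries that dimension.
  linked-generic : P a → ∀ cs → ∃[ a′ ] P a′ × Linked a a′ × e ≼ d (a′ ∷ []) cs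
  linked-generic {a} Pa cs =
    let c , Pc , c-generic = generic (a ∷ [])
    in from-copy Pc c-generic (generic-copy (a ∷ c ∷ []) {a * c ∷ []} {c ∷ a ∷ a * c ∷ cs}
         (base-⊆ λ { (here e) → there (there (here e)) }))
    where
    from-copy : ∀ {c} → P c → e ≼ d (c ∷ []) (a ∷ []) →
      Σ[ vs ∈ Vec C 2 ] a ∷ c ∷ [] ~[ a * c ∷ [] ] vs × d (a ∷ c ∷ []) (a * c ∷ []) ≼ d vs (c ∷ a ∷ a * c ∷ cs) →
      ∃[ a′ ] P a′ × Linked a a′ × e ≼ d (a′ ∷ []) cs
    from-copy {c} Pc c-generic (a′ ∷ c′ ∷ [] , ac~ , copy-generic) = a′ , Pa′ ,
      record { r = c ; r′ = c′ ; Pr = Pc ; Pr′ = P-~ (# 1) ac~ Pc ; ar≡ = ac≡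
             ; large = +ᴿ-mono (a′-generic ⟫ d-⊆ {cs = c ∷ a ∷ []} (λ { (here e) → here e ; (there (here e)) → there (here e) })) c-generic
                       ⟫ d-∷-≥ a′ (c ∷ []) ⟫ d-closure (a′ ∷ c ∷ []) (c ∷ a′ ∷ []) (cl-there cl-here ∷ cl-here ∷ []) } ,
      (a′-generic ⟫ d-⊆ (λ z∈ → there (there (there z∈))))
      where
      Pa′ : P a′
      Pa′ = P-~ (# 0) ac~ Pa
      ac≡ : a * c ≡ a′ * c′
      ac≡ = ~-dfn ac~ (dfn-inst (inj₂ (here refl)) (dfn-≈ (var (# 0)) (fun mul (var (# 1) ∷ var (# 2) ∷ [])))) refl
      pair-generic : e ≼ d (a ∷ c ∷ []) (a * c ∷ [])
      pair-generic = +ᴿ-cancelˡ e-finite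
        (+ᴿ-mono c-generic (e≼d Pa) ⟫ d-∷-≥ c (a ∷ [])
         ⟫ d-closure (c ∷ a ∷ []) (a ∷ c ∷ a * c ∷ []) (cl-there cl-here ∷ cl-here ∷ [])
         ⟫ d-++-≤ (a ∷ c ∷ []) (a * c ∷ []) ⟫ +ᴿ-mono ≼-refl (*≼e Pa Pc) ⟫ +ᴿ-comm)
      a′-generic : e ≼ d (a′ ∷ []) (c ∷ a ∷ a * c ∷ cs)
      a′-generic = pair-generic ⟫ copy-generic ⟫ d-closure (a′ ∷ c′ ∷ []) (a′ ∷ [])
        (cl-here ∷ cl-*⁻ (P≢0 Pa′) cl-here (subst (_∈cl (a′ ∷ c ∷ a ∷ a * c ∷ cs)) ac≡ (cl-there (cl-there (cl-there cl-here)))) ∷ [])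

  linked-~ : a ∷ [] ~[ c ∷ [] ] b ∷ [] → Linked c a → Linked c b
  linked-~ {a} {c} {b} a~b link =
    let open Linked link
        g , ra~gb = homogeneity a~b r
        g′ , r′ra~ = homogeneity ra~gb r′
    in record { r = g ; r′ = g′ ; Pr = P-~ (# 0) ra~gb Pr ; Pr′ = P-~ (# 0) r′ra~ Pr′
              ; ar≡ = ~-dfn r′ra~ (dfn-inst (inj₂ (here refl))
                        (dfn-≈ (fun mul (var (# 0) ∷ var (# 2) ∷ [])) (fun mul (var (# 3) ∷ var (# 1) ∷ [])))) ar≡
              ; large = large ⟫ ~-d (~-sym ra~gb) }

  -- Scaled by a, the sum u + xv becomes au + bv. Ruzsa's inequality applies to au and -bv with
  -- shift af = bf′, where (f , f′) has the type of (r , r′) over a, b and f is also generic over u,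
  -- v. The shifted elements are a(u + f) and b(f′ - v).
  linked⇒good : P a → P b → Linked a b → x * a ≡ b → Good (a ∷ b ∷ []) x
  linked⇒good {a} {b} {x} Pa Pb link xa≡b = x∈ , λ {u} {v} Pu Pv → from-copy Pu Pv
      (generic-copy (r ∷ []) {b ∷ a ∷ []} {u ∷ v ∷ b ∷ a ∷ []} (base-⊆ λ z∈ → there (there z∈)))
    where
    open Linked link
    ax≡b : a * x ≡ b
    ax≡b = trans (𝔽.*-comm a x) xa≡b
    x∈ : x ∈cl (a ∷ b ∷ [])
    x∈ = cl-*⁻ (P≢0 Pa) cl-here (subst (_∈cl (a ∷ b ∷ [])) (sym ax≡b) (cl-there cl-here))
    r-generic : e ≼ d (r ∷ []) (b ∷ a ∷ [])
    r-generic = +ᴿ-cancelˡ e-finite (large ⟫ d-∷-≤ r (b ∷ []) ⟫ +ᴿ-mono ≼-refl (d≼e Pb) ⟫ +ᴿ-comm)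
    m : C
    m = - 1#
    from-copy : ∀ {u v} → P u → P v →
      Σ[ vs ∈ Vec C 1 ] r ∷ [] ~[ b ∷ a ∷ [] ] vs × d (r ∷ []) (b ∷ a ∷ []) ≼ d vs (u ∷ v ∷ b ∷ a ∷ []) →
      d (u + x * v ∷ []) (a ∷ b ∷ []) ≼ e
    from-copy {u} {v} Pu Pv (f ∷ [] , r~f , copy-generic) =
      d-closure (u + x * v ∷ []) (a * (u + x * v) ∷ []) (cl-*⁻ (P≢0 Pa) (cl-there cl-here) cl-here ∷ [])
      ⟫ ruzsa e-finite {u = a * u} {v = m * (b * v)} {r = a * f} split
          (r-generic ⟫ copy-generic ⟫ d-transfer (a * u ∷ m * (b * v) ∷ [])
            (cl-*⁻ (P≢0 Pa) (cl-there (cl-there (cl-there (cl-there cl-here)))) cl-here)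
            (cl-* (cl-there (cl-there (cl-there cl-here))) cl-here
             ∷ cl-* (cl-neg cl-1) (cl-* (cl-there (cl-there cl-here)) (cl-there cl-here)) ∷ [])
            (λ { (here e) → there (there (there (here e))) ; (there (here e)) → there (there (here e)) }))
          (d-closure (a * u + a * f ∷ []) (u + f ∷ [])
            (subst (_∈cl (u + f ∷ a ∷ b ∷ [])) (𝔽.distribˡ a u f) (cl-* (cl-there cl-here) cl-here) ∷ [])
           ⟫ d-⊆ (λ ()) ⟫ +≼e Pu Pf)
          (d-closure (m * (b * v) + a * f ∷ []) (f′ + m * v ∷ [])
            (subst (_∈cl (f′ + m * v ∷ a ∷ b ∷ [])) bf′≡ (cl-* (cl-there (cl-there cl-here)) cl-here) ∷ [])
           ⟫ proj₂ (good-⊆ (λ ()) (good-neg good-1)) Pf′ Pv)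
      where
      f′f~ = homogeneity r~f r′
      f′ : C
      f′ = proj₁ f′f~
      Pf : P f
      Pf = P-~ (# 0) r~f Pr
      Pf′ : P f′
      Pf′ = P-~ (# 0) (proj₂ f′f~) Pr′
      af≡bf′ : a * f ≡ b * f′
      af≡bf′ = ~-dfn (proj₂ f′f~) (dfn-inst (inj₂ (here refl)) (dfn-inst (inj₂ (there (here refl)))
        (dfn-≈ (fun mul (var (# 0) ∷ var (# 3) ∷ [])) (fun mul (var (# 1) ∷ var (# 2) ∷ []))))) ar≡
      bf′≡ : b * (f′ + m * v) ≡ m * (b * v) + a * f
      bf′≡ = trans (solve 4 (λ b f m v → b :* (f :+ m :* v) := m :* (b :* v) :+ b :* f) refl b f′ m v)
        (cong (m * (b * v) +_) (sym af≡bf′))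
      split : m * (b * v) + a * (u + x * v) ≡ a * u
      split = trans (solve 6 (λ a b u v x m → m :* (b :* v) :+ a :* (u :+ x :* v) := (m :* (b :* v) :+ a :* x :* v) :+ a :* u)
                      refl a b u v x m)
        (trans (cong (_+ a * u) (trans (cong (λ z → m * (b * v) + z * v) ax≡b)
          (trans (cong (_+ b * v) (trans (sym (𝔽P.-‿distribˡ-* 1# (b * v))) (cong -_ (𝔽.*-identityˡ (b * v))))) (𝔽.-‿inverseˡ (b * v)))))
          (𝔽.+-identityˡ (a * u)))

  -- Stable elements and quotients of realizations

  Stable : Subset F
  Stable x = ∃[ cs ] Good cs x

  stable-+ : Stable x → Stable y → Stable (x + y)
  stable-+ (cs , x-good) (cs′ , y-good) = cs ++ˡ cs′ , good-+ (good-⊆ ∈ˡ.∈-++⁺ˡ x-good) (good-⊆ (∈ˡ.∈-++⁺ʳ cs) y-good)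

  stable-* : Stable x → Stable y → Stable (x * y)
  stable-* (cs , x-good) (cs′ , y-good) = cs ++ˡ cs′ , good-* (good-⊆ ∈ˡ.∈-++⁺ˡ x-good) (good-⊆ (∈ˡ.∈-++⁺ʳ cs) y-good)

  stable-neg : Stable x → Stable (- x)
  stable-neg (cs , x-good) = cs , good-neg x-good

  stable-inverse : x * y ≡ 1# → Stable x → Stable y
  stable-inverse xy≡1 (cs , x-good) = cs , good-inverse xy≡1 x-good

  stable-quotient : x ≢ 0# → x * z ≡ y → Stable x → Stable y → Stable z
  stable-quotient {x} {z} {y} x≢0 xz≡y x-stable y-stable =
    let i , xi≡1 = inverse x x≢0
    in subst Stable (*-cancelˡ x≢0 (trans (solve 3 (λ x y i → x :* (y :* i) := y :* (x :* i)) refl x y i)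
         (trans (cong (y *_) xi≡1) (trans (𝔽.*-identityʳ y) (sym xz≡y)))))
         (stable-* y-stable (stable-inverse xi≡1 x-stable))

  divide : x ≢ 0# → ∀ y → ∃[ z ] z * x ≡ y
  divide {x} x≢0 y = let i , xi≡1 = inverse x x≢0 in
    y * i , trans (solve 3 (λ x y i → y :* i :* x := y :* (x :* i)) refl x y i) (trans (cong (y *_) xi≡1) (𝔽.*-identityʳ y))

  exchange : ∀ {a b a′ b′} → a + b ≡ a′ + b′ → a + - a′ ≡ b′ + - b
  exchange {a} {b} {a′} {b′} e = +-cancelˡ {a′ + b} (begin
    (a′ + b) + (a + - a′)   ≡⟨ solve 4 (λ a b a′ n → (a′ :+ b) :+ (a :+ n) := (a :+ b) :+ (a′ :+ n)) refl a b a′ (- a′) ⟩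
    (a + b) + (a′ + - a′)   ≡⟨ cong₂ _+_ e (𝔽.-‿inverseʳ a′) ⟩
    (a′ + b′) + 0#          ≡⟨ cong ((a′ + b′) +_) (𝔽.-‿inverseʳ b) ⟨
    (a′ + b′) + (b + - b)   ≡⟨ solve 4 (λ b a′ b′ n → (a′ :+ b′) :+ (b :+ n) := (a′ :+ b) :+ (b′ :+ n)) refl b a′ b′ (- b) ⟩
    (a′ + b) + (b′ + - b)   ∎)
    where open ≡-Reasoning

  difference≡0 : x + - y ≡ 0# → x ≡ y
  difference≡0 {x} {y} = 𝔽P.x∙y⁻¹≈ε⇒x≈y x y

  difference-* : ∀ x y z → (x + - y) * z ≡ x * z + - (y * z)
  difference-* x y z = trans (𝔽.distribʳ z x (- y)) (cong (x * z +_) (sym (𝔽P.-‿distribˡ-* y z)))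

  linked⇒stable : P a → P b → Linked a b → x * a ≡ b → Stable x
  linked⇒stable Pa Pb link xa≡b = _ , linked⇒good Pa Pb link xa≡b

  -- Take a′ linked to a and b′ linked to b, independent over a, b. The pair has dimension 2e there
  -- and its sum at most e, so a generic copy (a″ , b″) with the same sum differs from it. The copy
  -- is taken over a, b as well, so a″ and b″ stay linked to them. Then ((b″ - b′)/b) x = (a′ -
  -- a″)/a, and both coefficients are differences of stable elements.
  quotient-stable : P a → P b → x * a ≡ b → Stable x
  quotient-stable {a} {b} {x} Pa Pb xa≡b = from-generics (linked-generic Pa (a ∷ b ∷ []))
    where
    open ≡-Reasoning

    module Copy {a′ b′ a″ b″ : C} (Pa′ : P a′) (a-a′ : Linked a a′) (Pb′ : P b′) (b-b′ : Linked b b′)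
      (pair-generic : e ≼ d (b′ ∷ a′ ∷ []) (a′ + b′ ∷ a ∷ b ∷ []))
      (ba~ : b′ ∷ a′ ∷ [] ~[ a′ + b′ ∷ a ∷ b ∷ [] ] b″ ∷ a″ ∷ [])
      (copy-generic : d (b′ ∷ a′ ∷ []) (a′ + b′ ∷ a ∷ b ∷ []) ≼ d (b″ ∷ a″ ∷ []) (b′ ∷ a′ ∷ a′ + b′ ∷ a ∷ b ∷ [])) where

      Pa″ : P a″
      Pa″ = P-~ (# 1) ba~ Pa′
      Pb″ : P b″
      Pb″ = P-~ (# 0) ba~ Pb′
      a-a″ : Linked a a″
      a-a″ = linked-~ (~-base (base-⊆ λ { (here e) → there (here e) }) (~-select (# 1 ∷ []) ba~)) a-a′
      b-b″ : Linked b b″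
      b-b″ = linked-~ (~-base (base-⊆ λ { (here e) → there (there (here e)) }) (~-select (# 0 ∷ []) ba~)) b-b′
      s≡ : a′ + b′ ≡ a″ + b″
      s≡ = ~-dfn ba~ (dfn-inst (inj₂ (here refl)) (dfn-≈ (var (# 0)) (fun add (var (# 2) ∷ var (# 1) ∷ [])))) refl
      a′≢a″ : a′ ≢ a″
      a′≢a″ a′≡a″ = e-positive (pair-generic ⟫ copy-generic ⟫
        d-zero (cl-∈ (here b″≡b′) ∷ cl-∈ (there (here (sym a′≡a″))) ∷ []))
        where
        b″≡b′ : b″ ≡ b′
        b″≡b′ = +-cancelˡ (trans (sym s≡) (cong (_+ b′) a′≡a″))

      stable : ∀ {u₁ u₂ w₁ w₂} → u₁ * a ≡ a′ → u₂ * a ≡ a″ → w₁ * b ≡ b′ → w₂ * b ≡ b″ → Stable x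
      stable {u₁} {u₂} {w₁} {w₂} u₁a≡ u₂a≡ w₁b≡ w₂b≡ = stable-quotient w≢0 wx≡u
        (stable-+ (linked⇒stable Pb Pb″ b-b″ w₂b≡) (stable-neg (linked⇒stable Pb Pb′ b-b′ w₁b≡)))
        (stable-+ (linked⇒stable Pa Pa′ a-a′ u₁a≡) (stable-neg (linked⇒stable Pa Pa″ a-a″ u₂a≡)))
        where
        u w : C
        u = u₁ + - u₂
        w = w₂ + - w₁
        ua≡ : u * a ≡ a′ + - a″
        ua≡ = trans (difference-* u₁ u₂ a) (cong₂ (λ y z → y + - z) u₁a≡ u₂a≡)
        wb≡ : w * b ≡ b″ + - b′
        wb≡ = trans (difference-* w₂ w₁ b) (cong₂ (λ y z → y + - z) w₂b≡ w₁b≡)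
        u≢0 : u ≢ 0#
        u≢0 u≡0 = a′≢a″ (difference≡0 (trans (sym ua≡) (trans (cong (_* a) u≡0) (𝔽.zeroˡ a))))
        wx≡u : w * x ≡ u
        wx≡u = *-cancelˡ (P≢0 Pa) (begin
          a * (w * x)  ≡⟨ solve 3 (λ a w x → a :* (w :* x) := w :* (x :* a)) refl a w x ⟩
          w * (x * a)  ≡⟨ cong (w *_) xa≡b ⟩
          w * b        ≡⟨ wb≡ ⟩
          b″ + - b′    ≡⟨ exchange s≡ ⟨
          a′ + - a″    ≡⟨ ua≡ ⟨
          u * a        ≡⟨ 𝔽.*-comm u a ⟩
          a * u        ∎)
        w≢0 : w ≢ 0#
        w≢0 w≡0 = u≢0 (trans (sym wx≡u) (trans (cong (_* x) w≡0) (𝔽.zeroˡ x)))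

    from-copy : ∀ {a′ b′} → P a′ → Linked a a′ → P b′ → Linked b b′ → e ≼ d (b′ ∷ a′ ∷ []) (a′ + b′ ∷ a ∷ b ∷ []) →
      Σ[ vs ∈ Vec C 2 ] b′ ∷ a′ ∷ [] ~[ a′ + b′ ∷ a ∷ b ∷ [] ] vs ×
        d (b′ ∷ a′ ∷ []) (a′ + b′ ∷ a ∷ b ∷ []) ≼ d vs (b′ ∷ a′ ∷ a′ + b′ ∷ a ∷ b ∷ []) →
      Stable x
    from-copy {a′} {b′} Pa′ a-a′ Pb′ b-b′ pair-generic (b″ ∷ a″ ∷ [] , ba~ , copy-generic) =
      Copy.stable Pa′ a-a′ Pb′ b-b′ pair-generic ba~ copy-generic
        (proj₂ (divide (P≢0 Pa) a′)) (proj₂ (divide (P≢0 Pa) a″)) (proj₂ (divide (P≢0 Pb) b′)) (proj₂ (divide (P≢0 Pb) b″))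

    pair : ∀ {a′ b′} → P a′ → P b′ → e ≼ d (a′ ∷ []) (a ∷ b ∷ []) → e ≼ d (b′ ∷ []) (a′ ∷ a ∷ b ∷ []) →
           e ≼ d (b′ ∷ a′ ∷ []) (a′ + b′ ∷ a ∷ b ∷ [])
    pair {a′} {b′} Pa′ Pb′ a′-generic b′-generic = +ᴿ-cancelˡ e-finite
      (+ᴿ-mono b′-generic a′-generic ⟫ d-∷-≥ b′ (a′ ∷ [])
       ⟫ d-closure (b′ ∷ a′ ∷ []) (b′ ∷ a′ ∷ a′ + b′ ∷ []) (cl-here ∷ cl-there cl-here ∷ [])
       ⟫ d-++-≤ (b′ ∷ a′ ∷ []) (a′ + b′ ∷ [])
       ⟫ +ᴿ-mono ≼-refl (d-⊆ (λ ()) ⟫ +≼e Pa′ Pb′) ⟫ +ᴿ-comm)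

    from-generics : ∃[ a′ ] P a′ × Linked a a′ × e ≼ d (a′ ∷ []) (a ∷ b ∷ []) → Stable x
    from-generics (a′ , Pa′ , a-a′ , a′-generic) =
      let b′ , Pb′ , b-b′ , b′-generic = linked-generic Pb (a′ ∷ a ∷ b ∷ [])
      in from-copy Pa′ a-a′ Pb′ b-b′ (pair Pa′ Pb′ a′-generic b′-generic)
           (generic-copy (b′ ∷ a′ ∷ []) {a′ + b′ ∷ a ∷ b ∷ []} {b′ ∷ a′ ∷ a′ + b′ ∷ a ∷ b ∷ []}
             (base-⊆ λ z∈ → there (there z∈)))

  -- The subfield of quotients of differences

  K : Subset F
  K = (P ⊖ P) ⊘ (P ⊖ P)

  -- Dividing numerator and denominator by a turns (a - a′)/(b - b′) into (1 - a′/a)/(b/a - b′/a),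
  -- built from quotients of realizations.
  K⇒stable : K z → Stable z
  K⇒stable {z} (x , y , (a , a′ , Pa , Pa′ , refl) , (b , b′ , Pb , Pb′ , refl) , y≢0 , zy≡x) =
    let k , ka≡ = divide (P≢0 Pa) a′
        u , ua≡ = divide (P≢0 Pa) b
        w , wa≡ = divide (P≢0 Pa) b′
        1-k = trans (difference-* 1# k a) (cong₂ (λ y z → y + - z) (𝔽.*-identityˡ a) ka≡)
        u-w = trans (difference-* u w a) (cong₂ (λ y z → y + - z) ua≡ wa≡)
    in stable-quotient
         (λ u-w≡0 → y≢0 (trans (sym u-w) (trans (cong (_* a) u-w≡0) (𝔽.zeroˡ a))))
         (*-cancelˡ (P≢0 Pa) (begin
           a * ((u + - w) * z)  ≡⟨ solve 3 (λ a t z → a :* (t :* z) := z :* (t :* a)) refl a (u + - w) z ⟩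
           z * ((u + - w) * a)  ≡⟨ cong (z *_) u-w ⟩
           z * (b + - b′)       ≡⟨ zy≡x ⟩
           a + - a′             ≡⟨ 1-k ⟨
           (1# + - k) * a       ≡⟨ 𝔽.*-comm _ a ⟩
           a * (1# + - k)       ∎))
         (stable-+ (quotient-stable Pa Pb ua≡) (stable-neg (quotient-stable Pa Pb′ wa≡)))
         (stable-+ ([] , good-1) (stable-neg (quotient-stable Pa Pa′ ka≡)))
    where open ≡-Reasoning

  -- `sum≡` and `v≢v′` display x as the element (u′ - u)/(v - v′) of `K`; `large` and `generic′`
  -- feed the dimension count in `stable-d≼e`.
  record Collision (cs : List C) (x : C) : Set ℓ where
    field
      u v u′ v′ : C
      Pu        : P u
      Pv        : P v
      Pu′       : P u′
      Pv′       : P v′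
      v≢v′      : v ≢ v′
      sum≡      : u + x * v ≡ u′ + x * v′
      large     : e +ᴿ e ≼ d (v ∷ u ∷ []) cs
      generic′  : d (v ∷ u ∷ []) (u + x * v ∷ cs) ≼ d (v′ ∷ u′ ∷ []) (v ∷ u ∷ u + x * v ∷ cs)

  -- A map with image of dimension less than 2e cannot be injective on p × p.
  collision : {f : ℝ̄ ℓ} → ¬ (e +ᴿ e ≼ f) → x ∈ˡ cs → (∀ {a b} → P a → P b → d (a + x * b ∷ []) cs ≼ f) → Collision cs x
  collision {x} {cs} {f} e+e⋠f x∈ sum≼f =
    let a , Pa , a-generic = generic cs
        b , Pb , b-generic = generic (a ∷ cs)
    in from-copy Pa Pb (+ᴿ-mono b-generic a-generic ⟫ d-∷-≥ b (a ∷ []))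
         (generic-copy (b ∷ a ∷ []) {a + x * b ∷ cs} {b ∷ a ∷ a + x * b ∷ cs} (base-⊆ λ z∈ → there (there z∈)))
    where
    from-copy : ∀ {a b} → P a → P b → e +ᴿ e ≼ d (b ∷ a ∷ []) cs →
      Σ[ vs ∈ Vec C 2 ] b ∷ a ∷ [] ~[ a + x * b ∷ cs ] vs ×
        d (b ∷ a ∷ []) (a + x * b ∷ cs) ≼ d vs (b ∷ a ∷ a + x * b ∷ cs) →
      Collision cs x
    from-copy {a} {b} Pa Pb large (b′ ∷ a′ ∷ [] , ba~ , copy-generic) = record
      { u = a ; v = b ; u′ = a′ ; v′ = b′ ; Pu = Pa ; Pv = Pb
      ; Pu′ = P-~ (# 1) ba~ Pa ; Pv′ = P-~ (# 0) ba~ Pb ; v≢v′ = b≢b′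
      ; sum≡ = sum≡ ; large = large ; generic′ = copy-generic }
      where
      w = a + x * b
      sum≡ : w ≡ a′ + x * b′
      sum≡ = ~-dfn ba~ (dfn-inst (inj₂ (here refl)) (dfn-inst (inj₂ (there x∈))
        (dfn-≈ (var (# 1)) (fun add (var (# 3) ∷ fun mul (var (# 0) ∷ var (# 2) ∷ []) ∷ []))))) refl
      b≢b′ : b ≢ b′
      b≢b′ refl = e+e⋠f (large
        ⟫ d-closure (b ∷ a ∷ []) (b ∷ a ∷ w ∷ []) (cl-here ∷ cl-there cl-here ∷ [])
        ⟫ d-++-≤ (b ∷ a ∷ []) (w ∷ [])
        ⟫ +ᴿ-comm ⟫ x+y≼x (copy-generic ⟫ d-zero (cl-here ∷ subst (_∈cl _) a≡a′ (cl-there cl-here) ∷ []))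
        ⟫ sum≼f Pa Pb)
        where
        a≡a′ : a ≡ a′
        a≡a′ = +-cancelˡ (trans (𝔽.+-comm (x * b) a) (trans sum≡ (𝔽.+-comm a′ (x * b))))

  K-intro : ∀ {a a′ b b′} → P a → P a′ → P b → P b′ → b ≢ b′ → z * (b + - b′) ≡ a + - a′ → K z
  K-intro Pa Pa′ Pb Pb′ b≢b′ eq =
    _ , _ , (_ , _ , Pa , Pa′ , refl) , (_ , _ , Pb , Pb′ , refl) , (λ b-b′≡0 → b≢b′ (difference≡0 b-b′≡0)) , eq

  module _ {cs : List C} {x : C} (c : Collision cs x) where
    open Collision c

    collision-difference : x * (v + - v′) ≡ u′ + - u
    collision-difference = trans (𝔽.distribˡ x v (- v′))
      (trans (cong (x * v +_) (sym (𝔽P.-‿distribʳ-* x v′))) (sym (exchange (sym sum≡))))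

    collision⇒K : K x
    collision⇒K = K-intro Pu′ Pu Pv Pv′ v≢v′ collision-difference

  e+e⋠e : ¬ (e +ᴿ e ≼ e)
  e+e⋠e e+e≼e = e-positive (+ᴿ-cancelˡ e-finite (e+e≼e ⟫ x≼x+y ≼-refl))

  good⇒collision : Good cs x → Collision (x ∷ cs) x
  good⇒collision (_ , x≼) = collision e+e⋠e (here refl) (λ Pa Pb → d-drop ⟫ x≼ Pa Pb)

  stable⇒K : Stable x → K x
  stable⇒K (cs , x-good) = collision⇒K (good⇒collision x-good)

  K-isSubfield : IsSubfield K
  K-isSubfield = record
    { 0∈    = stable⇒K ([] , good-0)
    ; 1∈    = stable⇒K ([] , good-1)
    ; +-∈   = λ x∈ y∈ → stable⇒K (stable-+ (K⇒stable x∈) (K⇒stable y∈))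
    ; neg-∈ = λ x∈ → stable⇒K (stable-neg (K⇒stable x∈))
    ; *-∈   = λ x∈ y∈ → stable⇒K (stable-* (K⇒stable x∈) (K⇒stable y∈))
    ; inv-∈ = λ x∈ _ xy≡1 → stable⇒K (stable-inverse xy≡1 (K⇒stable x∈))
    }

  -- Definability of `K`

  record Around (E : Def F 1) : Set ℓ where
    field
      over-base : Over F (base []) E
      contains  : P ⊆ ⟦ F ⟧₁ E

  open Around

  -- Immediate because `Around` asks for containment of `P` instead of membership in `p`, which is
  -- not closed under intersections by definition.
  around-∩ : {E E′ : Def F 1} → Around E → Around E′ →
             Σ[ G ∈ Def F 1 ] Around G × ⟦ F ⟧ G ⊆ ⟦ F ⟧ E ∩ ⟦ F ⟧ E′
  around-∩ {E} {E′} α α′ =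
    let G = dfn-∩ (dfn-Def {D = E} (over-base α)) (dfn-Def {D = E′} (over-base α′))
    in def G , record { over-base = over G ; contains = λ Pa → proj₂ (define G) (contains α Pa , contains α′ Pa) } , proj₁ (define G)

  around-∈p : {D : Def F 1} → D ∈ p → Around D
  around-∈p {D} D∈p = record
    { over-base = Allⱽ.map inj₁ (proj₁ (proj₁ p-complete) {D} D∈p) ; contains = λ Pa → Pa D D∈p }

  around-true : Σ[ E ∈ Def F 1 ] Around E
  around-true = def (dfn-true {1} {[]}) , record
    { over-base = over (dfn-true {1} {[]}) ; contains = λ {a} _ → proj₂ (define (dfn-true {1} {[]})) {a ∷ []} (λ ()) }

  e+e-positive : ¬ (e +ᴿ e ≼ 0ᴿ)
  e+e-positive e+e≼0 = e-positive (x≼x+y (0≼ e-finite) ⟫ e+e≼0)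

  -- Otherwise the pairs in E × E with a + xb outside D form a directed family of nonempty sets.
  -- Compactness gives realizations a, b of p with a + xb outside every set over `A`, x and `cs` of
  -- dimension below 2e, although `Good cs x` bounds its dimension by e < 2e.
  stable-uniform : Stable x → Σ[ E ∈ Def F 1 ] Around E × Σ[ D ∈ Def F 1 ] Below (e +ᴿ e) D ×
                   (∀ {a b} → ⟦ F ⟧₁ E a → ⟦ F ⟧₁ E b → ⟦ F ⟧₁ D (a + x * b))
  stable-uniform {x} (cs , _ , x≼) = by-contradiction λ none →
    let S-sat : ∀ i → Satisfiable (S i)
        S-sat = λ { ((E , α) , (D , oD , D-below)) → by-contradiction λ ¬sat → none (E , α , D , D-below ,
                  λ {a} {b} Ea Eb → by-contradiction λ ¬Dab →
                    ¬sat (a ∷ b ∷ [] , Ea , Eb , λ { (_ , refl , Dz) → ¬Dab Dz })) }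
        v , v∈ = compactness (base-small (x ∷ cs)) S S-dfn i₀ directed S-sat
        Pa : P (lookup v (# 0))
        Pa = λ D D∈p → proj₁ (v∈ ((D , around-∈p D∈p) , proj₂ i₀))
        Pb : P (lookup v (# 1))
        Pb = λ D D∈p → proj₁ (proj₂ (v∈ ((D , around-∈p D∈p) , proj₂ i₀)))
        q , e<q , ¬e+e<q = ⋠⇒gap e+e⋠e
        D , oD , ∈D , δ<q = d⁻ (≼⇒≤ᴿ (d-drop {c = x} ⟫ x≼ Pa Pb) e<q)
    in proj₂ (proj₂ (v∈ (proj₁ i₀ , (D , oD , q , δ<q , ¬e+e<q)))) (_ , refl , ∈D)
    where
    I : Set ℓ
    I = (Σ[ E ∈ Def F 1 ] Around E) × (Σ[ D ∈ Def F 1 ] Over F (base (x ∷ cs)) D × Below (e +ᴿ e) D)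
    S : I → Pred (Vec C 2) ℓ
    S ((E , _) , (D , _)) v = ⟦ F ⟧ E (lookup v (# 0) ∷ []) × ⟦ F ⟧ E (lookup v (# 1) ∷ []) ×
      ¬ (∃[ z ] z ≡ lookup v (# 0) + x * lookup v (# 1) × ⟦ F ⟧ D (z ∷ []))
    S-dfn : ∀ i → Dfn (base (x ∷ cs)) (S i)
    S-dfn ((E , α) , (D , oD , _)) = dfn-∩ (dfn-select (# 0 ∷ []) E-dfn) (dfn-∩ (dfn-select (# 1 ∷ []) E-dfn)
      (dfn-¬ (dfn-∃ (dfn-∩
        (dfn-inst (inj₂ (here refl)) (dfn-≈ (var (# 1)) (fun add (var (# 2) ∷ fun mul (var (# 0) ∷ var (# 3) ∷ []) ∷ []))))
        (dfn-select (# 0 ∷ []) (dfn-Def {D = D} oD))))))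
      where
      E-dfn : Dfn (base (x ∷ cs)) (⟦ F ⟧ E)
      E-dfn = dfn-⊆ (base-⊆ λ ()) (dfn-Def {D = E} (over-base α))
    empty : Dfn (base (x ∷ cs)) {1} (λ _ → Poly.⊥)
    empty = dfn-false
    i₀ : I
    i₀ = around-true , def empty , over empty , δ-empty {cs = x ∷ cs} e+e-positive
    directed : ∀ i j → Σ[ k ∈ I ] S k ⊆ S i ∩ S j
    directed ((E , α) , (D , o , D-below)) ((E′ , α′) , (D′ , o′ , D′-below)) =
      let G , γ , G⊆ = around-∩ α α′
          Y = dfn-∪ (dfn-Def {D = D} o) (dfn-Def {D = D′} o′)
      in ((G , γ) , (def Y , over Y , below-∪ {x = e +ᴿ e} {D} {D′} {def Y} D-below D′-below (define Y))) ,
         λ { (Ga , Gb , ¬Y) →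
           (proj₁ (G⊆ Ga) , proj₁ (G⊆ Gb) , λ (z , z≡ , Dz) → ¬Y (z , z≡ , proj₂ (define Y) (inj₁ Dz))) ,
           (proj₂ (G⊆ Ga) , proj₂ (G⊆ Gb) , λ (z , z≡ , Dz) → ¬Y (z , z≡ , proj₂ (define Y) (inj₂ Dz))) }

  -- The dimension of E + yE stays below 2e for all y in a definable neighbourhood of x, by continuity.
  stable-locally : Stable x → Σ[ L ∈ Def F 1 ] Over F (base []) L × ⟦ F ⟧₁ L x × ⟦ F ⟧₁ L ⊆ K
  stable-locally {x} x-stable = around (stable-uniform x-stable)
    where
    around : (Σ[ E ∈ Def F 1 ] Around E × Σ[ D ∈ Def F 1 ] Below (e +ᴿ e) D ×
               (∀ {a b} → ⟦ F ⟧₁ E a → ⟦ F ⟧₁ E b → ⟦ F ⟧₁ D (a + x * b))) →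
             Σ[ L ∈ Def F 1 ] Over F (base []) L × ⟦ F ⟧₁ L x × ⟦ F ⟧₁ L ⊆ K
    around (E , α , D , (q , δD<q , ¬e+e<q) , E+xE⊆D) =
      -- `D` may have parameters outside `A`, but it serves only to bound `δ (G-at x)`; the
      -- parameters of the neighbourhood come from `E`. The slack `r < q` goes into continuity,
      -- which keeps `δ (G-at y)` below `q`, hence below 2e, on all of θ.
      let r , r<q , δ<r = open′ (δ (G-at x)) (≼⇒≤ᴿ (δ-mono {D = G-at x} {D} G-at⊆D) δD<q)
          θ , below , above , _ = θ-exists (formula G) r<q
      in (θ [ params G ]) , over sums , below (x ∷ params G) δ<r , λ {y} y∈θ → collision⇒K
           (collision {x = y} {cs = y ∷ []} {f = δ (G-at y)} (λ e+e≼ → ¬e+e<q (≼⇒≤ᴿ e+e≼ (above (y ∷ params G) y∈θ))) (here refl)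
             λ {a} {b} Pa Pb → d≼δ (dfn-Def {D = G-at y} (over-at {cs = []} G (y ∷ []) (over sums)))
               (proj₂ (define sums) {a + y * b ∷ y ∷ []} (b , a , contains α Pa , contains α Pb , refl)))
      where
      sums : Dfn (base []) {2} (λ v → ∃[ b ] ∃[ a ] ⟦ F ⟧ E (a ∷ []) × ⟦ F ⟧ E (b ∷ []) ×
                                         lookup v (# 0) ≡ a + lookup v (# 1) * b)
      sums = dfn-∃ (dfn-∃ (dfn-∩ (dfn-select (# 0 ∷ []) (dfn-Def {D = E} (over-base α)))
        (dfn-∩ (dfn-select (# 1 ∷ []) (dfn-Def {D = E} (over-base α)))
          (dfn-≈ (var (# 2)) (fun add (var (# 0) ∷ fun mul (var (# 3) ∷ var (# 1) ∷ []) ∷ []))))))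
      G : Def F 2
      G = def sums
      G-at : C → Def F 1
      G-at y = at-params G (y ∷ [])
      G-at⊆D : ⟦ F ⟧ (G-at x) ⊆ ⟦ F ⟧ D
      G-at⊆D {z ∷ []} z∈ = unpack (proj₁ (define sums) {z ∷ x ∷ []} z∈)
        where
        unpack : (∃[ b ] ∃[ a ] ⟦ F ⟧ E (a ∷ []) × ⟦ F ⟧ E (b ∷ []) × z ≡ a + x * b) → ⟦ F ⟧₁ D z
        unpack (b , a , Ea , Eb , refl) = E+xE⊆D Ea Eb

  -- `P` is only type-definable, so its quadruples are approximated by those of sets `E` around p,
  -- leaving out quotients covered by some `D ⊆ K`. If an approximation is empty, its `D` is all of
  -- `K`. If none is, compactness gives an element of `K` outside every such `D`, against
  -- `stable-locally`.
  K-definable : Σ[ D ∈ Def F 1 ] Over F (base []) D × ⟦ F ⟧₁ D ≐ K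
  K-definable = by-contradiction λ (none : ¬ (Σ[ D ∈ Def F 1 ] Over F (base []) D × ⟦ F ⟧₁ D ≐ K)) →
    outside (compactness (base-small []) S S-dfn i₀ directed λ { i@(_ , (D , oD , D⊆K)) →
      by-contradiction λ ¬sat → none (D , oD , D⊆K , covered i ¬sat) })
    where
    I : Set ℓ
    I = (Σ[ E ∈ Def F 1 ] Around E) × (Σ[ D ∈ Def F 1 ] Over F (base []) D × ⟦ F ⟧₁ D ⊆ K)
    S : I → Pred (Vec C 4) ℓ
    S ((E , _) , (D , _)) v =
      (⟦ F ⟧₁ E (lookup v (# 0)) × ⟦ F ⟧₁ E (lookup v (# 1)) × ⟦ F ⟧₁ E (lookup v (# 2)) × ⟦ F ⟧₁ E (lookup v (# 3))) ×
      ¬ (lookup v (# 2) ≡ lookup v (# 3)) ×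
      ¬ (∃[ z ] z * (lookup v (# 2) + - lookup v (# 3)) ≡ lookup v (# 0) + - lookup v (# 1) × ⟦ F ⟧₁ D z)
    S-dfn : ∀ i → Dfn (base []) (S i)
    S-dfn ((E , α) , (D , oD , _)) = dfn-∩
      (dfn-∩ (E-at (# 0)) (dfn-∩ (E-at (# 1)) (dfn-∩ (E-at (# 2)) (E-at (# 3)))))
      (dfn-∩ (dfn-¬ (dfn-≈ (var (# 2)) (var (# 3))))
        (dfn-¬ (dfn-∃ (dfn-∩
          (dfn-≈ (fun mul (var (# 0) ∷ difference (# 3) (# 4) ∷ [])) (difference (# 1) (# 2)))
          (dfn-select (# 0 ∷ []) (dfn-Def {D = D} oD))))))
      where
      E-at : (i : Fin 4) → Dfn (base []) (λ v → ⟦ F ⟧ E (lookup v i ∷ []))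
      E-at i = dfn-select (i ∷ []) (dfn-Def {D = E} (over-base α))
      difference : Fin 5 → Fin 5 → Term L 5
      difference i j = fun add (var i ∷ fun neg (var j ∷ []) ∷ [])
    covered : ∀ i → ¬ Satisfiable (S i) → K ⊆ ⟦ F ⟧₁ (proj₁ (proj₂ i))
    covered ((E , α) , (D , _)) ¬sat {z} (_ , _ , (a , a′ , Pa , Pa′ , refl) , (b , b′ , Pb , Pb′ , refl) , b-b′≢0 , zb≡) =
      by-contradiction λ z∉D → ¬sat (a ∷ a′ ∷ b ∷ b′ ∷ [] ,
        (contains α Pa , contains α Pa′ , contains α Pb , contains α Pb′) ,
        (λ { refl → b-b′≢0 (𝔽.-‿inverseʳ b) }) ,
        λ (w , wb≡ , w∈D) → z∉D (subst (⟦ F ⟧₁ D) (*-cancelˡ b-b′≢0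
          (trans (𝔽.*-comm _ w) (trans wb≡ (trans (sym zb≡) (𝔽.*-comm z _))))) w∈D))
    empty : Dfn (base []) {1} (λ _ → Poly.⊥)
    empty = dfn-false
    i₀ : I
    i₀ = around-true , def empty , over empty , λ {z} z∈ → Poly.⊥-elim (proj₁ (define empty) {z ∷ []} z∈)
    directed : ∀ i j → Σ[ k ∈ I ] S k ⊆ S i ∩ S j
    directed ((E , α) , (D , o , D⊆K)) ((E′ , α′) , (D′ , o′ , D′⊆K)) =
      let G , γ , G⊆ = around-∩ α α′
          Y = dfn-∪ (dfn-Def {D = D} o) (dfn-Def {D = D′} o′)
      in ((G , γ) , (def Y , over Y , λ z∈ → [ D⊆K , D′⊆K ]′ (proj₁ (define Y) z∈))) ,
         λ { ((Ga , Ga′ , Gb , Gb′) , b≢b′ , ¬Y) →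
           ((proj₁ (G⊆ Ga) , proj₁ (G⊆ Ga′) , proj₁ (G⊆ Gb) , proj₁ (G⊆ Gb′)) , b≢b′ ,
             λ (z , z≡ , Dz) → ¬Y (z , z≡ , proj₂ (define Y) (inj₁ Dz))) ,
           ((proj₂ (G⊆ Ga) , proj₂ (G⊆ Ga′) , proj₂ (G⊆ Gb) , proj₂ (G⊆ Gb′)) , b≢b′ ,
             λ (z , z≡ , Dz) → ¬Y (z , z≡ , proj₂ (define Y) (inj₂ Dz))) }
    outside : ¬ Satisfiable (λ v → ∀ i → S i v)
    outside (v , v∈) =
      let at-p = λ D (D∈p : D ∈ p) → proj₁ (v∈ ((D , around-∈p D∈p) , proj₂ i₀))
          b≢b′ = proj₁ (proj₂ (v∈ i₀))
          z , z≡ = divide (λ b-b′≡0 → b≢b′ (difference≡0 b-b′≡0)) _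
          z∈K = K-intro (λ D D∈p → proj₁ (at-p D D∈p)) (λ D D∈p → proj₁ (proj₂ (at-p D D∈p)))
                  (λ D D∈p → proj₁ (proj₂ (proj₂ (at-p D D∈p)))) (λ D D∈p → proj₂ (proj₂ (proj₂ (at-p D D∈p)))) b≢b′ z≡
          D , oD , z∈D , D⊆K = stable-locally (K⇒stable z∈K)
      in proj₂ (proj₂ (v∈ (proj₁ i₀ , (D , oD , D⊆K)))) (z , z≡ , z∈D)

  -- The dimension of `K`

  e≼δK : (D : Def F 1) → Over F (base []) D → K ⊆ ⟦ F ⟧₁ D → e ≼ δ D
  e≼δK D oD K⊆D =
    let b′ , Pb′ , _         = generic []
        b , Pb , b-generic   = generic (b′ ∷ [])
        a , Pa , a-generic   = generic (b ∷ b′ ∷ [])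
        b≢b′ : b ≢ b′
        b≢b′ = λ b≡b′ → generic∉cl b-generic (cl-∈ (here b≡b′))
        -- With `b′` subtracted in both differences, a = z(b - b′) + b′ is recovered from z, b and
        -- b′, so z inherits the dimension of a.
        z , z≡ = divide (λ b-b′≡0 → b≢b′ (difference≡0 b-b′≡0)) (a + - b′)
        cs = z ∷ b ∷ b′ ∷ []
        a∈ : a ∈cl cs
        a∈ = cl-+⁻ {x = - b′} (cl-neg (cl-there (cl-there cl-here)))
               (subst (_∈cl cs) (trans z≡ (𝔽.+-comm a (- b′)))
                 (cl-* cl-here (cl-+ (cl-there cl-here) (cl-neg (cl-there (cl-there cl-here))))))
    in a-generic ⟫ d-closure (a ∷ []) (z ∷ []) (a∈ ∷ []) ⟫ d-⊆ {cs = []} (λ ())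
       ⟫ d≼δ (dfn-Def {D = D} oD) (K⊆D (K-intro Pa Pb′ Pb Pb′ b≢b′ z≡))

  -- Counting: a collision (u , v , u′ , v′) has dimension at most 4e and at least 3e over x, and determines x.
  stable-d≼e : Stable x → d (x ∷ []) [] ≼ e
  stable-d≼e {x} (cs , x-good@(_ , x≼)) = from-collision (good⇒collision x-good)
    where
    from-collision : Collision (x ∷ cs) x → d (x ∷ []) [] ≼ e
    from-collision c = +ᴿ-cancelˡ (finite-+ e-finite (finite-+ e-finite e-finite))
      (+ᴿ-mono three ≼-refl ⟫ d-++-≥ (v′ ∷ u′ ∷ v ∷ u ∷ []) (x ∷ [])
       ⟫ d-closure (v′ ∷ u′ ∷ v ∷ u ∷ x ∷ []) (v′ ∷ u′ ∷ v ∷ u ∷ [])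
           (v′∈ ∷ u′∈ ∷ v∈ ∷ u∈ ∷ cl-*⁻ (λ v-v′≡0 → v≢v′ (difference≡0 v-v′≡0)) (cl-+ v∈ (cl-neg v′∈))
             (subst (_∈cl (v′ ∷ u′ ∷ v ∷ u ∷ [])) (trans (sym (collision-difference c)) (𝔽.*-comm x _)) (cl-+ u′∈ (cl-neg u∈))) ∷ [])
       ⟫ d-∷-≤ v′ (u′ ∷ v ∷ u ∷ [])
       ⟫ +ᴿ-mono (d≼e Pv′) (d-∷-≤ u′ (v ∷ u ∷ []) ⟫ +ᴿ-mono (d≼e Pu′) (d-∷-≤ v (u ∷ []) ⟫ +ᴿ-mono (d≼e Pv) (d≼e Pu)))
       ⟫ +ᴿ-comm)
      where
      open Collision c
      w : C
      w = u + x * v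
      v′∈ : v′ ∈cl (v′ ∷ u′ ∷ v ∷ u ∷ [])
      v′∈ = cl-here
      u′∈ : u′ ∈cl (v′ ∷ u′ ∷ v ∷ u ∷ [])
      u′∈ = cl-there cl-here
      v∈ : v ∈cl (v′ ∷ u′ ∷ v ∷ u ∷ [])
      v∈ = cl-there (cl-there cl-here)
      u∈ : u ∈cl (v′ ∷ u′ ∷ v ∷ u ∷ [])
      u∈ = cl-there (cl-there (cl-there cl-here))
      -- The pair (v , u) has dimension at least 2e and w at most e, as x is good; `generic′` passes
      -- the remaining e on to (v′ , u′).
      fibre : e ≼ d (v ∷ u ∷ []) (w ∷ x ∷ cs)
      fibre = +ᴿ-cancelˡ e-finite (large
        ⟫ d-closure (v ∷ u ∷ []) (v ∷ u ∷ w ∷ []) (cl-here ∷ cl-there cl-here ∷ [])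
        ⟫ d-++-≤ (v ∷ u ∷ []) (w ∷ []) ⟫ +ᴿ-mono ≼-refl (d-drop ⟫ x≼ Pu Pv) ⟫ +ᴿ-comm)
      three : e +ᴿ (e +ᴿ e) ≼ d (v′ ∷ u′ ∷ v ∷ u ∷ []) (x ∷ [])
      three = +ᴿ-mono
        (fibre ⟫ generic′ ⟫ d-⊆ {cs = v ∷ u ∷ x ∷ []}
          λ { (here e) → here e ; (there (here e)) → there (here e) ; (there (there (here e))) → there (there (there (here e))) })
        (large ⟫ d-⊆ {cs = x ∷ []} λ { (here e) → here e })
        ⟫ d-++-≥ (v′ ∷ u′ ∷ []) (v ∷ u ∷ [])

  -- A nonempty set definable over `A` attains its dimension at a point, by `generic-point` for a
  -- constant family, and points of `K` have dimension at most e. The bound `e ≼ δ D` excludes the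
  -- empty set.
  δK≼e : (D : Def F 1) → Over F (base []) D → ⟦ F ⟧₁ D ⊆ K → e ≼ δ D → δ D ≼ e
  δK≼e D oD D⊆K e≼δD = from-point (generic-point {I = ⊤} (λ _ → ⟦ F ⟧ D) (λ _ → dfn-Def {D = D} oD) tt
      (λ _ _ → tt , λ x∈ → x∈ , x∈) (λ _ → satisfiable) {δ D} (λ _ → ≼-refl))
    where
    satisfiable : Satisfiable (⟦ F ⟧ D)
    satisfiable = by-contradiction λ none → e-positive (e≼δD ⟫ proj₁ (≃⇒≋ (finite D ([] , λ {v} v∈ → ⊥-elim (none (v , v∈))))))
    from-point : Σ[ v ∈ Vec C 1 ] (⊤ → ⟦ F ⟧ D v) × δ D ≼ d v [] → δ D ≼ e
    from-point (x ∷ [] , x∈ , δ≼d) = δ≼d ⟫ stable-d≼e (K⇒stable (D⊆K (x∈ tt)))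

δ*-mono : {ℓ : Level} {L : Language ℓ} (F : Structure L) (dim : Dimension F) {Q Q′ : Subset F} →
          Q ⊆ Q′ → δ* F dim Q ≼ δ* F dim Q′
δ*-mono F dim Q⊆Q′ = ⟨ (λ ((D , Q′⊆D) , δ<q) → (D , λ x∈ → Q′⊆D (Q⊆Q′ x∈)) , δ<q) ⟩

theorem6p6 : (∀ {a} → ExcludedMiddle a) →
    ∀ {ℓ : Level} {L : Language ℓ} (R : RingSymbols L)
    (T : Theory {L = L}) → Complete T → ExpandsFields R T →
    (F : Structure L) → F ⊨ T →
    (dim : Dimension F) →
    (κ : Set ℓ) → SufficientlySaturated F κ →
    (A : Subset F) → A ≺ κ →
    let open FieldOps R F
        δ = Dimension.δ dim
        δ⁺ = δ* F dim
    in
    (X : Subset F) (Γ : Pred (Def F 1) ℓ) →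
    PartialType F A Γ → X ≐ Realizations₁ F Γ →
    0ᴿ <ᴿ δ⁺ (X ⊕ X) → δ⁺ (X ⊕ X) ≃ᴿ δ⁺ (X ⊗ X) → δ⁺ (X ⊗ X) ≃ᴿ δ⁺ X → δ⁺ X <ᴿ ∞ᴿ →
    (p : Pred (Def F 1) ℓ) → IsGeneric F dim A Γ p →
    let P = Realizations₁ F p
        K = (P ⊖ P) ⊘ (P ⊖ P)
    in
    IsSubfield K ×
    (Σ[ D ∈ Def F 1 ] ⟦_⟧₁ F D ≐ K × δ D ≃ᴿ δ⁺ X)
theorem6p6 em R T _ T⇒field F F⊨T dim κ (ℕ≺κ , _ , saturated) A A≺κ X Γ _ (X⊆Γ , Γ⊆X)
  (q , 0<q , ¬X⊕X<q) X⊕X≃X⊗X X⊗X≃X (r , X<r , _) p (p-complete , Γ⊆p , δP≃δΓ) =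
  K-isSubfield ,
  (let D , oD , D⊆K , K⊆D = K-definable
       e≼δD = e≼δK D oD K⊆D
   in D , (D⊆K , K⊆D) , ≼⇒≤ᴿ (δK≼e D oD D⊆K e≼δD) , ≼⇒≤ᴿ e≼δD)
  where
  open FieldOps R F
  e = δ* F dim X
  X⊗X≼e : δ* F dim (X ⊗ X) ≼ e
  X⊗X≼e = proj₁ (≃⇒≋ X⊗X≃X)
  X⊕X≼e : δ* F dim (X ⊕ X) ≼ e
  X⊕X≼e = proj₁ (≃⇒≋ X⊕X≃X⊗X) ⟫ X⊗X≼e
  e-finite : Finite⁺ e
  e-finite = finite⁺ ⟨ (λ ((D , _) , δ<q) → Dimension.nonneg dim D δ<q) ⟩ (r , X<r)
  e-positive : ¬ e ≼ 0ᴿ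
  e-positive ⟨ e≤0 ⟩ = ¬X⊕X<q (≼⇒≤ᴿ X⊕X≼e (e≤0 0<q))
  δP≼e : δ* F dim (Realizations₁ F p) ≼ e
  δP≼e = proj₁ (≃⇒≋ δP≃δΓ) ⟫ δ*-mono F dim Γ⊆X
  e≼δP : e ≼ δ* F dim (Realizations₁ F p)
  e≼δP = δ*-mono F dim X⊆Γ ⟫ proj₂ (≃⇒≋ δP≃δΓ)
  open GenericType em R F (T⇒field F F⊨T) dim κ ℕ≺κ saturated A A≺κ p p-complete X (λ Px → Γ⊆X λ D D∈Γ → Px D (Γ⊆p D∈Γ))
    e e-finite e-positive δP≼e e≼δP X⊕X≼e X⊗X≼e
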